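{- Let $R$ be a finite chain ring of length $2$ with residue field $\mathbb{F}_q$, and let $n=2q+t$ with $0\le t\le q-2$. Then $$\mathrm{m}_n(R)\ge\begin{cases} q(q+1)n-q^3+2q^2-4q-2t & \text{if } t\le q-5,\\ q(q+1)n-q^3+2q^2-8q+16 & \text{if } t=q-4,\\ q(q+1)n-q^3+q^2-2q & \text{if } t=q-3,\\ q(q+1)n-q^3 & \text{if } t=q-2.\end{cases}$$ Equivalently, there exist projective $\bigl(q^3+(t+4)q^2+(t-4)q-2t,\,2q+t\bigr)$-arcs for $0\le t\le q-5$, and (whenever the respective $t=q-4,q-3,q-2$ is nonnegative) projective $(2q^3+q^2-12q+16,\,3q-4)$-, $(2q^3+q^2-5q,\,3q-3)$- and $(2q^3+q^2-2q,\,3q-2)$-arcs in $\mathrm{PHG}(2,R)$.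
   Context: Throughout, $R$ is a finite chain ring of nilpotency index (length) $2$, i.e. a finite local ring with radical $\mathrm{rad}R\neq 0$, $(\mathrm{rad}R)^2=0$, whose one-sided ideals form the chain $R\supsetneq\mathrm{rad}R\supsetneq 0$, with residue field $R/\mathrm{rad}R\cong\mathbb{F}_q$ ($q$ a prime power); then $|R|=q^2$. The projective Hjelmslev plane $\mathrm{PHG}(2,R)$ is the incidence structure whose points are the free rank-$1$ submodules of the right module $R_R^3$, whose lines are the free rank-$2$ submodules of $R_R^3$, with incidence given by inclusion; it has $q^4+q^3+q^2$ points and each line contains $q^2+q$ points. A $(k,n)$-arc is a map $\mathcal{K}$ from the point set to $\mathbb{N}_0$ with $\sum_x\mathcal{K}(x)=k$ and $\sum_{x\in L}\mathcal{K}(x)\le n$ for every line $L$; it is projective if $\mathcal{K}$ takes only values in $\{0,1\}$ (i.e. it is a set of $k$ points meeting every line in at most $n$ points). For $0\le n\le q^2+q$, $\mathrm{m}_n(R)$ denotes the largest $k$ such that a projective $(k,n)$-arc exists in $\mathrm{PHG}(2,R)$. -}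

module Defs where

open import Algebra.Bundles using (Ring; RawRing; CommutativeRing)
import Algebra.Construct.Flip.Op as Op
open import Algebra.Module.Bundles using (RightModule)
import Algebra.Module.Construct.DirectProduct as Product
import Algebra.Module.Construct.TensorUnit as Unit
open import Algebra.Morphism.Structures using (module RingMorphisms)
import Algebra.Properties.CommutativeMonoid.Sum as Sum
open import Data.Bool.Base using (Bool; true; false; T; if_then_else_)
open import Data.Bool.Properties using (T?)
open import Data.Fin.Base using (Fin; zero; suc)
import Data.Fin.Properties as Fin
open import Data.Fin.Subset using (Subset) renaming (_∈_ to _∈ˢ_)
open import Data.Fin.Subset.Properties using (anySubset?) renaming (_∈?_ to _∈ˢ?_)
open import Data.Integer.Base using (ℤ; +_)
open import Data.List.Base using (List; []; _∷_; [_]; map; filter; tabulate; deduplicate; cartesianProduct; cartesianProductWith; concatMap; length; lookup)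
open import Data.List.Membership.Setoid using (lose)
open import Data.List.Properties using (map-cong; filter-≐)
open import Data.List.Relation.Unary.All as All using ()
open import Data.List.Relation.Unary.Any as Any using (Any; here; there)
import Data.List.Relation.Unary.Any.Properties as Any
open import Data.List.Relation.Unary.Enumerates.Setoid using (IsEnumeration)
import Data.List.Relation.Unary.Enumerates.Setoid.Properties as Enumerates
open import Data.List.Relation.Unary.Unique.Setoid using (Unique)
import Data.List.Relation.Unary.Unique.DecSetoid.Properties as UniqueDec
open import Data.Nat.Base as ℕ using (ℕ; zero; suc; _≤_; z≤n; s≤s)
open import Data.Nat.ListAction using (sum)
open import Data.Nat.Primality using (Prime)
import Data.Nat.Properties as ℕ
open import Data.Product.Base using (∃; ∃₂; Σ; _×_; _,_; proj₁; proj₂)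
open import Data.Product.Relation.Binary.Pointwise.NonDependent using (_×ₛ_)
open import Data.Sum.Base using (_⊎_; inj₁; inj₂)
open import Data.Vec.Base as Vec using ()
open import Data.Vec.Properties using (lookup⇒[]=; []=⇒lookup; lookup∘tabulate)
open import Function.Base using (_∘_)
open import Function.Bundles using (Inverse; Func; _⇔_; mk⇔; Equivalence)
open import Level using (Level; _⊔_; 0ℓ) renaming (suc to lsuc)
open import Relation.Binary.Bundles using (Setoid; DecSetoid)
open import Relation.Binary.Definitions using () renaming (Decidable to Decidable₂)
open import Relation.Binary.PropositionalEquality as ≡ using (_≡_; refl)
open import Relation.Nullary using (¬_; Dec; yes; no; does; contradiction)
open import Relation.Nullary.Decidable using (map′; isYes; toWitness; fromWitness; dec-true; dec-false; does-⇔; _×-dec_; _→-dec_)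
open import Relation.Unary using (Pred; Decidable; U; _≐_)

private
  variable
    a b c ℓ m ℓm p : Level

HasSize : ℕ → Setoid a ℓ → Set (a ⊔ ℓ)
HasSize n S = Inverse S (≡.setoid (Fin n))

Finite : Setoid a ℓ → Set (a ⊔ ℓ)
Finite S = ∃ λ n → HasSize n S

record Enumerated (S : Setoid a ℓ) : Set (a ⊔ ℓ) where
  open Setoid S
  field
    _≟_      : Decidable₂ _≈_
    elements : List Carrier
    complete : IsEnumeration S elements
    unique   : Unique S elements

enumerated : (S : Setoid a ℓ) → Decidable₂ (Setoid._≈_ S) →
             (xs : List (Setoid.Carrier S)) → IsEnumeration S xs → Enumerated S
enumerated S _≟_ xs complete = record
  { _≟_      = _≟_
  ; elements = deduplicate _≟_ xs
  ; complete = Enumerates.deduplicate⁺ DS complete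
  ; unique   = UniqueDec.deduplicate-! DS xs
  }
  where
  DS = record { isDecEquivalence = record { isEquivalence = Setoid.isEquivalence S ; _≟_ = _≟_ } }

finite⇒enumerated : {S : Setoid a ℓ} → Finite S → Enumerated S
finite⇒enumerated {S = S} (n , inv) = enumerated S
  (λ x y → map′ (λ e → S.trans (S.sym (strictlyInverseʳ x)) (S.trans (from-cong e) (strictlyInverseʳ y)))
                to-cong (to x Fin.≟ to y))
  (tabulate from)
  (λ x → Any.tabulate⁺ (to x) (S.sym (strictlyInverseʳ x)))
  where
  open Inverse inv
  module S = Setoid S

module _ {S : Setoid a ℓ} (E : Enumerated S) {P : Pred (Setoid.Carrier S) p}
         (resp : ∀ {x y} → Setoid._≈_ S x y → P x → P y) (P? : Decidable P) where
  open Setoid S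
  open Enumerated E

  any? : Dec (∃ P)
  any? = map′ (λ h → Any.satisfied h)
              (λ (x , px) → lose S resp (complete x) px)
              (Any.any? P? elements)

  all? : Dec (∀ x → P x)
  all? = map′ (λ h x → All.lookupₛ S resp h (complete x))
              (λ h → All.universal h elements)
              (All.all? P? elements)

_×-enumerated_ : {S : Setoid a ℓ} {T : Setoid b m} → Enumerated S → Enumerated T → Enumerated (S ×ₛ T)
_×-enumerated_ {S = S} {T = T} E F = enumerated (S ×ₛ T)
  (λ (x , y) (x′ , y′) → (x E.≟ x′) ×-dec (y F.≟ y′))
  (cartesianProduct E.elements F.elements)
  (Enumerates.cartesianProduct⁺ S T E.complete F.complete)
  where
  module E = Enumerated E
  module F = Enumerated F

_^ₛ_ : Setoid a ℓ → ℕ → Setoid a ℓ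
S ^ₛ r = record
  { Carrier = Fin r → Carrier
  ; _≈_     = λ f g → ∀ i → f i ≈ g i
  ; isEquivalence = record
    { refl  = λ _ → Setoid.refl S
    ; sym   = λ e i → Setoid.sym S (e i)
    ; trans = λ e e′ i → Setoid.trans S (e i) (e′ i)
    }
  }
  where open Setoid S

^-enumerated : {S : Setoid a ℓ} → Enumerated S → ∀ r → Enumerated (S ^ₛ r)
^-enumerated {S = S} E r = enumerated (S ^ₛ r) (λ f g → Fin.all? (λ i → f i ≟ g i)) (fams r) (fams-complete r)
  where
  open Setoid S
  open Enumerated E

  cons : ∀ {r} → Carrier → (Fin r → Carrier) → Fin (suc r) → Carrier
  cons x f zero    = x
  cons x f (suc i) = f i

  fams : ∀ r → List (Fin r → Carrier)
  fams zero    = [ (λ ()) ]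
  fams (suc r) = cartesianProductWith cons elements (fams r)

  cons-≈ : ∀ {r x} {f : Fin r → Carrier} {g : Fin (suc r) → Carrier} →
           g zero ≈ x → (∀ i → g (suc i) ≈ f i) → ∀ i → g i ≈ cons x f i
  cons-≈ e e′ zero    = e
  cons-≈ e e′ (suc i) = e′ i

  fams-complete : ∀ r → IsEnumeration (S ^ₛ r) (fams r)
  fams-complete zero    f = here λ ()
  fams-complete (suc r) f = Any.cartesianProductWith⁺ cons cons-≈
    (complete (f zero)) (fams-complete r (f ∘ suc))

-- Every submodule of a finite module is a decidable subset, so membership is
-- given by a Boolean function.  Quantifying over arbitrary predicates instead
-- would make hypotheses about "all ideals" imply excluded middle.
record Submodule {R : Ring c ℓ} (M : RightModule R m ℓm) : Set (c ⊔ m ⊔ ℓm) where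
  open Ring R using (Carrier)
  open RightModule M
  field
    member : Carrierᴹ → Bool
    resp   : ∀ {x y} → x ≈ᴹ y → T (member x) → T (member y)
    zero∈  : T (member 0ᴹ)
    +∈     : ∀ {x y} → T (member x) → T (member y) → T (member (x +ᴹ y))
    *∈     : ∀ {x} (r : Carrier) → T (member x) → T (member (x *ᵣ r))

module _ {R : Ring c ℓ} {M : RightModule R m ℓm} where
  open Ring R using (Carrier; _≈_; 0#)
  open RightModule M

  infix 4 _∈_ _⊆_ _≋_

  _∈_ : Carrierᴹ → Submodule M → Set
  x ∈ N = T (Submodule.member N x)

  _⊆_ : Submodule M → Submodule M → Set m
  N ⊆ N′ = ∀ x → x ∈ N → x ∈ N′

  _≋_ : Submodule M → Submodule M → Set m
  N ≋ N′ = N ⊆ N′ × N′ ⊆ N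

  combination : ∀ {r} → (Fin r → Carrierᴹ) → (Fin r → Carrier) → Carrierᴹ
  combination v s = Sum.sum +ᴹ-commutativeMonoid (λ i → v i *ᵣ s i)

  Independent : ∀ {r} → (Fin r → Carrierᴹ) → Set (c ⊔ ℓ ⊔ ℓm)
  Independent v = ∀ s → combination v s ≈ᴹ 0ᴹ → ∀ i → s i ≈ 0#

  Spans : ∀ {r} → (Fin r → Carrierᴹ) → Submodule M → Set (c ⊔ m ⊔ ℓm)
  Spans v N = ∀ x → x ∈ N ⇔ (∃ λ s → x ≈ᴹ combination v s)

  IsFree : ℕ → Submodule M → Set (c ⊔ ℓ ⊔ m ⊔ ℓm)
  IsFree r N = ∃ λ (v : Fin r → Carrierᴹ) → Independent v × Spans v N

module _ (R : Ring c ℓ) where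
  open Ring R

  RightIdeal : Set (c ⊔ ℓ)
  RightIdeal = Submodule (Unit.rightModule {R = R})

  IsMaximal : RightIdeal → Set (c ⊔ ℓ)
  IsMaximal I = (∃ λ x → ¬ x ∈ I) ×
                (∀ (J : RightIdeal) → I ⊆ J → J ⊆ I ⊎ (∀ x → x ∈ J))

  Rad : Pred Carrier (c ⊔ ℓ)
  Rad x = ∀ I → IsMaximal I → x ∈ I

  IsLocal : Set (c ⊔ ℓ)
  IsLocal = ∃ λ I → IsMaximal I × (∀ J → IsMaximal J → J ≋ I)

  -- R / rad R as a setoid quotient: equality is congruence modulo rad R.
  residueRing : RawRing c (c ⊔ ℓ)
  residueRing = record
    { Carrier = Carrier
    ; _≈_     = λ x y → Rad (x - y)
    ; _+_     = _+_
    ; _*_     = _*_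
    ; -_      = -_
    ; 0#      = 0#
    ; 1#      = 1#
    }

LeftIdeal : Ring c ℓ → Set (c ⊔ ℓ)
LeftIdeal R = RightIdeal (Op.ring R)

IsPrimePower : ℕ → Set
IsPrimePower q = ∃₂ λ p k → Prime p × q ≡ p ℕ.^ suc k

record FiniteField a b (q : ℕ) : Set (lsuc (a ⊔ b)) where
  field
    commutativeRing : CommutativeRing a b
  open CommutativeRing commutativeRing public
  field
    1≉0     : ¬ 1# ≈ 0#
    inverse : ∀ x → ¬ x ≈ 0# → ∃ λ y → x * y ≈ 1#
    size    : HasSize q setoid

record IsChainRingOfLength2 (R : Ring c ℓ) {q : ℕ} (F : FiniteField a b q) :
                            Set (c ⊔ ℓ ⊔ a ⊔ b) where
  open Ring R
  private
    module F = FiniteField F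
    OneOfThree : Pred Carrier 0ℓ → Set (c ⊔ ℓ)
    OneOfThree I = I ≐ U ⊎ I ≐ Rad R ⊎ I ≐ (_≈ 0#)
  field
    finite       : Finite setoid
    local        : IsLocal R
    Rad≢R        : ∃ λ x → ¬ Rad R x
    Rad≢0        : ∃ λ x → Rad R x × ¬ x ≈ 0#
    -- (rad R)² is generated by these products.
    Rad²≡0       : ∀ x y → Rad R x → Rad R y → x * y ≈ 0#
    rightIdeals  : (I : RightIdeal R) → OneOfThree (_∈ I)
    leftIdeals   : (I : LeftIdeal R) → OneOfThree (_∈ I)
    residueField : ∃ λ (φ : Carrier → F.Carrier) →
                   RingMorphisms.IsRingIsomorphism (residueRing R) F.rawRing φ

module FreeSubmodules {R : Ring c ℓ} (M : RightModule R m ℓm)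
                      (ER : Enumerated (Ring.setoid R))
                      (EM : Enumerated (RightModule.≈ᴹ-setoid M)) where
  open Ring R using (Carrier; _≈_; 0#; setoid; +-congˡ)
  module R = Ring R
  open RightModule M
  open Sum +ᴹ-commutativeMonoid using (sum-cong-≋; ∑-distrib-+) renaming (sum to ∑)

  FreeSubmodule : ℕ → Set (c ⊔ ℓ ⊔ m ⊔ ℓm)
  FreeSubmodule r = Σ (Submodule M) (IsFree r)

  freeSubmodules : ℕ → Setoid (c ⊔ ℓ ⊔ m ⊔ ℓm) m
  freeSubmodules r = record
    { Carrier = FreeSubmodule r
    ; _≈_     = λ (N , _) (N′ , _) → N ≋ N′
    ; isEquivalence = record
      { refl  = (λ _ h → h) , (λ _ h → h)
      ; sym   = λ (f , g) → g , f
      ; trans = λ (f , g) (f′ , g′) → (λ x h → f′ x (f x h)) , (λ x h → g x (g′ x h))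
      }
    }

  abstract
    _⊆?_ : (N N′ : Submodule M) → Dec (N ⊆ N′)
    N ⊆? N′ = all? EM (λ e h z → Submodule.resp N′ e (h (Submodule.resp N (≈ᴹ-sym e) z)))
                   (λ x → T? (Submodule.member N x) →-dec T? (Submodule.member N′ x))

  private
    module EM = Enumerated EM
    module ER = Enumerated ER
    module _ {r : ℕ} where

      combination-cong : {v w : Fin r → Carrierᴹ} {s t : Fin r → Carrier} →
        (∀ i → v i ≈ᴹ w i) → (∀ i → s i ≈ t i) → combination {M = M} v s ≈ᴹ combination {M = M} w t
      combination-cong e e′ = sum-cong-≋ (λ i → *ᵣ-cong (e i) (e′ i))

      ∑0 : (f : Fin r → Carrierᴹ) → (∀ i → f i ≈ᴹ 0ᴹ) → ∑ f ≈ᴹ 0ᴹ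
      ∑0 f e = ≈ᴹ-trans (sum-cong-≋ e) (Sum.sum-replicate-zero +ᴹ-commutativeMonoid r)

    ∑-*ᵣ : ∀ {r} (f : Fin r → Carrierᴹ) t → ∑ f *ᵣ t ≈ᴹ ∑ (λ i → f i *ᵣ t)
    ∑-*ᵣ {zero}  f t = *ᵣ-zeroˡ t
    ∑-*ᵣ {suc r} f t = ≈ᴹ-trans (*ᵣ-distribʳ t _ _) (+ᴹ-cong ≈ᴹ-refl (∑-*ᵣ (f ∘ suc) t))

    module _ {r : ℕ} (v : Fin r → Carrierᴹ) where

      InSpan : Carrierᴹ → Set (c ⊔ ℓm)
      InSpan x = ∃ λ s → x ≈ᴹ combination {M = M} v s

      inSpan? : Decidable InSpan
      inSpan? x = any? (^-enumerated ER r)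
        (λ e h → ≈ᴹ-trans h (combination-cong (λ _ → ≈ᴹ-refl) e))
        (λ s → x EM.≟ combination {M = M} v s)

      independent? : Dec (Independent {M = M} v)
      independent? = all? (^-enumerated ER r)
        (λ e h z i → R.trans (R.sym (e i)) (h (≈ᴹ-trans (combination-cong (λ _ → ≈ᴹ-refl) e) z) i))
        (λ s → (combination {M = M} v s EM.≟ 0ᴹ) →-dec Fin.all? (λ i → s i ER.≟ 0#))

      toT : ∀ {x} → InSpan x → T (isYes (inSpan? x))
      toT = fromWitness

      fromT : ∀ {x} → T (isYes (inSpan? x)) → InSpan x
      fromT = toWitness

  span : ∀ {r} → (Fin r → Carrierᴹ) → Submodule M
  span {r} v = record
    { member = λ x → isYes (inSpan? v x)
    ; resp   = λ e h → let s , z = fromT v h in toT v (s , ≈ᴹ-trans (≈ᴹ-sym e) z)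
    ; zero∈  = toT v ((λ _ → 0#) , ≈ᴹ-sym (∑0 {r} _ (λ i → *ᵣ-zeroʳ (v i))))
    ; +∈     = λ h h′ → let s , z = fromT v h ; s′ , z′ = fromT v h′ in
                 toT v ((λ i → s i R.+ s′ i) ,
                   ≈ᴹ-trans (+ᴹ-cong z z′) (≈ᴹ-sym (≈ᴹ-trans
                     (sum-cong-≋ {n = r} (λ i → *ᵣ-distribˡ (v i) (s i) (s′ i)))
                     (∑-distrib-+ {n = r} (λ i → v i *ᵣ s i) (λ i → v i *ᵣ s′ i)))))
    ; *∈     = λ t h → let s , z = fromT v h in
                 toT v ((λ i → s i R.* t) ,
                   ≈ᴹ-trans (*ᵣ-cong z R.refl) (≈ᴹ-trans (∑-*ᵣ {r} (λ i → v i *ᵣ s i) t)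
                     (sum-cong-≋ {n = r} (λ i → *ᵣ-assoc (v i) (s i) t))))
    }

  span-spans : ∀ {r} (v : Fin r → Carrierᴹ) → Spans v (span v)
  span-spans v x = mk⇔ (fromT v) (toT v)

  private
    fromBasis : ∀ {r} → (Fin r → Carrierᴹ) → List (FreeSubmodule r)
    fromBasis v with independent? v
    ... | yes ind = [ (span v , v , ind , span-spans v) ]
    ... | no  _   = []

    fromBasis-complete : ∀ {r} ((N , v , _) : FreeSubmodule r) {w} → (∀ i → v i ≈ᴹ w i) →
      Any (λ N′ → N ≋ proj₁ N′) (fromBasis w)
    fromBasis-complete (N , v , ind , spans) {w} e with independent? w
    ... | yes _ = here
      ( (λ x h → let s , z = Equivalence.to (spans x) h in
          toT w (s , ≈ᴹ-trans z (combination-cong e (λ _ → R.refl))))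
      , (λ x h → let s , z = fromT w h in
          Equivalence.from (spans x)
            (s , ≈ᴹ-trans z (combination-cong (λ i → ≈ᴹ-sym (e i)) (λ _ → R.refl)))))
    ... | no ¬ind = contradiction
      (λ s z → ind s (≈ᴹ-trans (combination-cong e (λ _ → R.refl)) z)) ¬ind

  -- Abstract: only completeness and uniqueness of the enumeration matter, and
  -- unfolding it is expensive.
  abstract
    freeSubmodules-enumerated : ∀ r → Enumerated (freeSubmodules r)
    freeSubmodules-enumerated r = enumerated (freeSubmodules r)
      (λ (N , _) (N′ , _) → (N ⊆? N′) ×-dec (N′ ⊆? N))
      (concatMap fromBasis (Enumerated.elements EV))
      (λ F@(N , v , _) → Any.concatMap⁺ fromBasis
        (Any.map (fromBasis-complete F) (Enumerated.complete EV v)))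
      where
      EV : Enumerated (≈ᴹ-setoid ^ₛ r)
      EV = ^-enumerated EM r

IsLargest : Pred ℕ p → ℕ → Set p
IsLargest P k = P k × (∀ j → P j → j ≤ k)

largestBelow : {P : Pred ℕ p} → Decidable P → ℕ → ℕ
largestBelow P? zero    = zero
largestBelow P? (suc B) = if does (P? (suc B)) then suc B else largestBelow P? B

largestBelow-isLargest : {P : Pred ℕ p} (P? : Decidable P) (B : ℕ) →
  ∃ P → (∀ j → P j → j ≤ B) → IsLargest P (largestBelow P? B)
largestBelow-isLargest P? zero (j , pj) bound with z≤n ← bound j pj = pj , bound
largestBelow-isLargest P? (suc B) ex bound with P? (suc B)
... | yes pB = pB , bound
... | no ¬pB = largestBelow-isLargest P? B ex λ j pj →
  ℕ.≤-pred (ℕ.≤∧≢⇒< (bound j pj) λ { refl → ¬pB pj })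

module PHG (R : Ring c ℓ) (finite : Finite (Ring.setoid R)) where

  R³ : RightModule R c ℓ
  R³ = Product.rightModule R₁ (Product.rightModule R₁ R₁)
    where R₁ = Unit.rightModule {R = R}

  private
    ER = finite⇒enumerated finite

  open FreeSubmodules R³ ER (ER ×-enumerated (ER ×-enumerated ER))

  Point Line : Set (c ⊔ ℓ)
  Point = FreeSubmodule 1
  Line  = FreeSubmodule 2

  pointSetoid : Setoid (c ⊔ ℓ) c
  pointSetoid = freeSubmodules 1

  infix 4 _on_ _on?_

  _on_ : Point → Line → Set c
  (x , _) on (L , _) = x ⊆ L

  _on?_ : (x : Point) (L : Line) → Dec (x on L)
  (x , _) on? (L , _) = x ⊆? L

  open Enumerated (freeSubmodules-enumerated 1) public
    using () renaming (_≟_ to _≟ᴾ_; elements to points; complete to points-complete; unique to points-unique)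

  Multiset : Set (c ⊔ ℓ)
  Multiset = Func pointSetoid (≡.setoid ℕ)

  open Func using (to; cong)

  -- Sums over points are sums over the repetition-free list of all points.
  total : Multiset → ℕ
  total K = sum (map (to K) points)

  onLine : Multiset → Line → ℕ
  onLine K L = sum (map (to K) (filter (_on? L) points))

  IsArc : ℕ → ℕ → Multiset → Set (c ⊔ ℓ)
  IsArc k n K = total K ≡ k × (∀ L → onLine K L ≤ n)

  IsProjective : Multiset → Set (c ⊔ ℓ)
  IsProjective K = ∀ x → to K x ≡ 0 ⊎ to K x ≡ 1

  ProjectiveArc : ℕ → ℕ → Set (c ⊔ ℓ)
  ProjectiveArc k n = ∃ λ K → IsArc k n K × IsProjective K

  -- For parameters given by integer formulas involving subtraction.
  ProjectiveArcℤ : ℤ → ℤ → Set (c ⊔ ℓ)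
  ProjectiveArcℤ k n = ∃₂ λ k′ n′ → + k′ ≡ k × + n′ ≡ n × ProjectiveArc k′ n′

  private
    filter-cong : ∀ {L L′ : Line} → proj₁ L ≋ proj₁ L′ → ∀ xs → filter (_on? L) xs ≡ filter (_on? L′) xs
    filter-cong {L} {L′} (f , g) = filter-≐ (_on? L) (_on? L′) ((λ h y z → f y (h y z)) , (λ h y z → g y (h y z)))

    isArc? : ∀ k n K → Dec (IsArc k n K)
    isArc? k n K = (total K ℕ.≟ k) ×-dec
      all? (freeSubmodules-enumerated 2)
        (λ {L} {L′} e → ≡.subst (λ xs → sum (map (to K) xs) ≤ n) (filter-cong {L} {L′} e points))
        (λ L → onLine K L ℕ.≤? n)

    Marked : Subset (length points) → Point → Set c
    Marked S x = ∃ λ i → i ∈ˢ S × proj₁ (lookup points i) ≋ proj₁ x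

    marked? : ∀ S x → Dec (Marked S x)
    marked? S x = Fin.any? (λ i → (i ∈ˢ? S) ×-dec (lookup points i ≟ᴾ x))

    module P = Setoid pointSetoid

    characteristic : Subset (length points) → Multiset
    characteristic S = record
      { to   = λ x → if does (marked? S x) then 1 else 0
      ; cong = λ {x} {y} e → ≡.cong (if_then 1 else 0) (does-⇔ (mk⇔
          (λ (i , h , z) → i , h , P.trans {lookup points i} {x} {y} z e)
          (λ (i , h , z) → i , h , P.trans {lookup points i} {y} {x} z (P.sym {x} {y} e)))
          (marked? S x) (marked? S y))
      }

    characteristic-projective : ∀ S → IsProjective (characteristic S)
    characteristic-projective S x with does (marked? S x)
    ... | true  = inj₂ refl
    ... | false = inj₁ refl

    support : Multiset → Subset (length points)
    support K = Vec.tabulate λ i → does (to K (lookup points i) ℕ.≟ 1)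

    characteristic-support : ∀ K → IsProjective K → ∀ x → to K x ≡ to (characteristic (support K)) x
    characteristic-support K proj x with proj x
    ... | inj₂ Kx≡1 = ≡.trans Kx≡1 (≡.cong (if_then 1 else 0) (≡.sym (dec-true (marked? (support K) x)
      ( i
      , lookup⇒[]= i _ (≡.trans (lookup∘tabulate _ i) (dec-true (_ ℕ.≟ 1) (≡.trans (cong K {_} {x} i≈x) Kx≡1)))
      , i≈x))))
      where
      i = Any.index (points-complete x)
      i≈x = P.sym {x} {lookup points i} (Any.lookup-index (points-complete x))
    ... | inj₁ Kx≡0 = ≡.trans Kx≡0 (≡.cong (if_then 1 else 0) (≡.sym (dec-false (marked? (support K) x)
      λ (i , h , z) → 0≢1 (≡.trans (≡.sym (≡.trans (cong K {_} {x} z) Kx≡0))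
        (holds (_ ℕ.≟ 1) (≡.trans (≡.sym (lookup∘tabulate _ i)) ([]=⇒lookup h)))))))
      where
      0≢1 : ¬ 0 ≡ 1
      0≢1 ()
      holds : ∀ {A : Set} (A? : Dec A) → does A? ≡ true → A
      holds (yes x) _ = x

    isArc-cong : ∀ {k n} {K K′ : Multiset} → (∀ x → to K x ≡ to K′ x) → IsArc k n K → IsArc k n K′
    isArc-cong e (t , l) =
      ≡.trans (≡.cong sum (map-cong (≡.sym ∘ e) points)) t ,
      λ L → ≡.subst (_≤ _) (≡.cong sum (map-cong e (filter (_on? L) points))) (l L)

  projectiveArc? : ∀ k n → Dec (ProjectiveArc k n)
  projectiveArc? k n = map′
    (λ (S , h) → characteristic S , h , characteristic-projective S)
    (λ (K , h , pr) → support K ,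
      isArc-cong {K = K} {K′ = characteristic (support K)} (characteristic-support K pr) h)
    (anySubset? (λ S → isArc? k n (characteristic S)))

  -- Searching up to the number of points suffices: see m-isLargest.
  m[_] : ℕ → ℕ
  m[ n ] = largestBelow (λ k → projectiveArc? k n) (length points)

  m-isLargest : ∀ n → IsLargest (λ k → ProjectiveArc k n) m[ n ]
  m-isLargest n = largestBelow-isLargest (λ k → projectiveArc? k n) (length points)
    (0 , empty , (sum0 points , λ L → ≡.subst (_≤ n) (≡.sym (sum0 (filter (_on? L) points))) z≤n) , λ _ → inj₁ refl)
    (λ j (K , (t , _) , pr) → ≡.subst (_≤ _) t (sum≤ K pr points))
    where
    empty : Multiset
    empty = record { to = λ _ → 0 ; cong = λ _ → refl }
    sum0 : ∀ xs → sum (map (to empty) xs) ≡ 0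
    sum0 []       = refl
    sum0 (x ∷ xs) = sum0 xs
    sum≤ : ∀ K → IsProjective K → ∀ xs → sum (map (to K) xs) ≤ length xs
    sum≤ K pr []       = z≤n
    sum≤ K pr (x ∷ xs) = ℕ.+-mono-≤ (≤1 (pr x)) (sum≤ K pr xs)
      where
      ≤1 : ∀ {k} → k ≡ 0 ⊎ k ≡ 1 → k ≤ 1
      ≤1 (inj₁ refl) = z≤n
      ≤1 (inj₂ refl) = s≤s z≤n

{-# OPTIONS --safe #-}

-- Write J = rad R = π R, so J² = 0, and r = q - 2 - t.  The neighbour classes of points are the q²
-- points of an affine plane over the residue field, with coordinates (x , y), and the q + 1 classes
-- at infinity; each class is itself an affine plane of order q, in which the lines of one neighbour
-- class cut out a parallel class of segments.  Fix a set X of r residues.  An affine class with x ∉ X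
-- receives two parallel segments of slope x, one with x ∈ X a single vertical segment.  A line of
-- slope m ∉ X then meets at most q + 2 (t + 1) + r = 2 q + t of these points, one of slope m ∈ X
-- only 2 (t + 2) + r, and so there is room for q - 2 points per line in the class at infinity of slope m.
-- Vertical lines over x ∉ X meet 2 q points; over x ∈ X the segments are given the offset y², so that
-- a vertical line, whose equation becomes a monic quadratic in y, contains at most two of them.
-- The vertical class at infinity can still take t points per line, and the sizes of the sets at
-- infinity are limited only by the lines close to the line at infinity.

module Submission where

open import Defs
open import Algebra.Bundles using (Ring; CommutativeMonoid)
open import Algebra.Module.Bundles using (RightModule)
open import Algebra.Morphism.Structures using (module RingMorphisms)
import Algebra.Properties.CommutativeMonoid.Sum as CommutativeMonoidSum
import Algebra.Properties.CommutativeSemigroup as CommutativeSemigroup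
import Algebra.Properties.Ring as RingProperties
import Algebra.Solver.CommutativeMonoid as CommutativeMonoidSolver
import Algebra.Solver.Ring.NaturalCoefficients.Default as SemiringSolver
open import Data.Bool.Base using (Bool; true; false; T; if_then_else_)
open import Data.Fin.Base using (Fin; zero; suc; punchIn; _↑ˡ_; _↑ʳ_; splitAt; inject≤)
open import Data.Fin.Patterns using (0F; 1F; 2F)
import Data.Fin.Properties as Fin
open import Data.List.Base using ([]; _∷_; map; filter)
open import Data.List.Relation.Unary.All as All using (All; []; _∷_)
import Data.List.Relation.Unary.All.Properties as All
open import Data.List.Relation.Unary.AllPairs as AllPairs using (AllPairs; []; _∷_)
open import Data.List.Relation.Unary.Any as Any using (Any; here; there)
open import Data.Nat as ℕ using (ℕ; zero; suc; _≤_; _<_; z≤n; s≤s)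
open import Data.Nat.ListAction using () renaming (sum to sumᴸ)
import Data.Nat.Properties as ℕ
import Data.Nat.Solver as ℕ-Solver
open import Data.Product using (∃; ∃₂; Σ; _×_; _,_; proj₁; proj₂)
open import Data.Sum.Base using (_⊎_; inj₁; inj₂)
open import Data.Unit.Base using (⊤; tt)
open import Function.Base using (_∘_)
open import Function.Bundles using (Inverse; Equivalence)
import Level
open import Relation.Binary.PropositionalEquality as ≡ using (_≡_; _≢_)
import Relation.Binary.Reasoning.Setoid as SetoidReasoning
open import Relation.Nullary using (¬_; Dec; yes; no; contradiction)
open import Relation.Nullary.Decidable using (isYes; toWitness; fromWitness; decidable-stable)
open import Relation.Unary using (Pred; Decidable)

-- Finite sums over nested index families.

module Sums where

  open import Data.Nat.Base using (_+_; _*_)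
  open ≡ using (refl)
  open CommutativeSemigroup ℕ.+-commutativeSemigroup using (interchange)
  private module Sum = CommutativeMonoidSum ℕ.+-0-commutativeMonoid

  0<+⇒ : ∀ m {n} → 0 < m + n → 0 < m ⊎ 0 < n
  0<+⇒ zero    h = inj₂ h
  0<+⇒ (suc m) h = inj₁ (s≤s z≤n)

  -- A zero count satisfies every bound, so a witness of positivity may be assumed while bounding
  -- it.
  ≤-if-pos : ∀ m {n} → (0 < m → m ≤ n) → m ≤ n
  ≤-if-pos zero    h = z≤n
  ≤-if-pos (suc m) h = h (s≤s z≤n)

  -- Abstract, so that a sum over Fin 2 is not unfolded and its summand can be inferred.
  abstract
    sum : ∀ {n} → (Fin n → ℕ) → ℕ
    sum = Sum.sum

    sum-[] : (f : Fin 0 → ℕ) → sum f ≡ 0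
    sum-[] f = refl

    sum-∷ : ∀ {n} (f : Fin (suc n) → ℕ) → sum f ≡ f zero + sum (f ∘ suc)
    sum-∷ f = refl

    sum-cong : ∀ {n} {f g : Fin n → ℕ} → (∀ i → f i ≡ g i) → sum f ≡ sum g
    sum-cong = Sum.sum-cong-≗

    sum-zero : ∀ n → sum {n} (λ _ → 0) ≡ 0
    sum-zero = Sum.sum-replicate-zero

    sum-+ : ∀ {n} (f g : Fin n → ℕ) → sum (λ i → f i + g i) ≡ sum f + sum g
    sum-+ = Sum.∑-distrib-+

    sum-const : ∀ n c → sum {n} (λ _ → c) ≡ n * c
    sum-const zero    c = refl
    sum-const (suc n) c = ≡.cong (c +_) (sum-const n c)

    sum-*ʳ : ∀ {n} (f : Fin n → ℕ) c → sum (λ i → f i * c) ≡ sum f * c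
    sum-*ʳ {zero}  f c = refl
    sum-*ʳ {suc n} f c = ≡.trans (≡.cong (f zero * c +_) (sum-*ʳ (f ∘ suc) c)) (≡.sym (ℕ.*-distribʳ-+ c (f zero) _))

    sum-mono : ∀ {n} {f g : Fin n → ℕ} → (∀ i → f i ≤ g i) → sum f ≤ sum g
    sum-mono {zero}  h = z≤n
    sum-mono {suc n} h = ℕ.+-mono-≤ (h zero) (sum-mono (h ∘ suc))

    sum-≤ : ∀ {n c} {f : Fin n → ℕ} → (∀ i → f i ≤ c) → sum f ≤ n * c
    sum-≤ {zero}  h = z≤n
    sum-≤ {suc n} h = ℕ.+-mono-≤ (h zero) (sum-≤ (h ∘ suc))

    sum-≤1 : ∀ {n} {f : Fin n → ℕ} → (∀ i → f i ≤ 1) → sum f ≤ n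
    sum-≤1 h = ℕ.≤-trans (sum-≤ h) (ℕ.≤-reflexive (ℕ.*-identityʳ _))

    sum-pos : ∀ {n} {f : Fin n → ℕ} → 0 < sum f → ∃ λ i → 0 < f i
    sum-pos {suc n} {f} h with 0<+⇒ (f zero) h
    ... | inj₁ p = zero , p
    ... | inj₂ p = let i , p′ = sum-pos p in suc i , p′

    -- The form in which geometry enters the counts: an equation of the line determines the index of
    -- every incident point at one level of a nested sum.
    sum-at-most-one : ∀ {n c} {f : Fin n → ℕ} → (∀ i → f i ≤ c) →
      (∀ i j → 0 < f i → 0 < f j → i ≡ j) → sum f ≤ c
    sum-at-most-one {zero}          h u = z≤n
    sum-at-most-one {suc n} {c} {f} h u with f zero in eq
    ... | zero  = sum-at-most-one (h ∘ suc) (λ i j p p′ → Fin.suc-injective (u (suc i) (suc j) p p′))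
    ... | suc k = begin
      suc k + sum (f ∘ suc) ≤⟨ ℕ.+-mono-≤ (ℕ.≤-reflexive (≡.sym eq)) rest ⟩
      f zero + 0            ≡⟨ ℕ.+-identityʳ _ ⟩
      f zero                ≤⟨ h zero ⟩
      c                     ∎
      where
      open ℕ.≤-Reasoning
      rest : sum (f ∘ suc) ≤ 0
      rest = ≤-if-pos _ λ p → let i , p′ = sum-pos p in
        contradiction (u zero (suc i) (≡.subst (0 <_) (≡.sym eq) (s≤s z≤n)) p′) λ ()

    -- Once an index with a positive term is found, fixing it in the hypothesis leaves the
    -- hypothesis of `sum-at-most-one` for the remaining terms.
    sum-at-most-two : ∀ {n c} {f : Fin n → ℕ} → (∀ i → f i ≤ c) →
      (∀ i j k → 0 < f i → 0 < f j → 0 < f k → i ≢ j → i ≢ k → j ≡ k) → sum f ≤ 2 * c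
    sum-at-most-two {zero}          h u = z≤n
    sum-at-most-two {suc n} {c} {f} h u with f zero in eq
    ... | zero  = sum-at-most-two (h ∘ suc) λ i j k p p′ p″ d d′ → Fin.suc-injective
      (u (suc i) (suc j) (suc k) p p′ p″ (d ∘ Fin.suc-injective) (d′ ∘ Fin.suc-injective))
    ... | suc k = begin
      suc k + sum (f ∘ suc) ≤⟨ ℕ.+-mono-≤ (ℕ.≤-trans (ℕ.≤-reflexive (≡.sym eq)) (h zero)) rest ⟩
      c + c                 ≡⟨ ≡.cong (c +_) (ℕ.+-identityʳ c) ⟨
      2 * c                 ∎
      where
      open ℕ.≤-Reasoning
      rest : sum (f ∘ suc) ≤ c
      rest = sum-at-most-one (h ∘ suc) λ i j p p′ → Fin.suc-injective
        (u zero (suc i) (suc j) (≡.subst (0 <_) (≡.sym eq) (s≤s z≤n)) p p′ (λ ()) (λ ()))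

    sum-peak : ∀ {n c₀ c} {f : Fin (suc n) → ℕ} i₀ → f i₀ ≤ c₀ →
      (∀ i → i₀ ≢ i → f i ≤ c) → sum f ≤ c₀ + n * c
    sum-peak {f = f} i₀ p h = ℕ.≤-trans (ℕ.≤-reflexive (Sum.sum-remove {i = i₀} f))
      (ℕ.+-mono-≤ p (sum-≤ λ j → h (punchIn i₀ j) (Fin.punchInᵢ≢i i₀ j ∘ ≡.sym)))

  -- Codes for the index types of point families. Keeping the nesting, instead of numbering the
  -- points, lets a sum be bounded level by level: column, class, segment, position.
  data Shape : Set where
    one   : Shape
    sigma : (n : ℕ) → (Fin n → Shape) → Shape
    _⊕_   : Shape → Shape → Shape

  infixr 4 _⊕_

  El : Shape → Set
  El one         = ⊤
  El (sigma n u) = Σ (Fin n) (El ∘ u)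
  El (u ⊕ v)     = El u ⊎ El v

  ∑ : ∀ u → (El u → ℕ) → ℕ
  ∑ one         f = f tt
  ∑ (sigma n u) f = sum λ i → ∑ (u i) λ c → f (i , c)
  ∑ (u ⊕ v)     f = ∑ u (f ∘ inj₁) + ∑ v (f ∘ inj₂)

  size : Shape → ℕ
  size u = ∑ u λ _ → 1

  ∑-cong : ∀ u {f g : El u → ℕ} → (∀ c → f c ≡ g c) → ∑ u f ≡ ∑ u g
  ∑-cong one         h = h tt
  ∑-cong (sigma n u) h = sum-cong λ i → ∑-cong (u i) λ c → h (i , c)
  ∑-cong (u ⊕ v)     h = ≡.cong₂ _+_ (∑-cong u (h ∘ inj₁)) (∑-cong v (h ∘ inj₂))

  ∑-mono : ∀ u {f g : El u → ℕ} → (∀ c → f c ≤ g c) → ∑ u f ≤ ∑ u g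
  ∑-mono one         h = h tt
  ∑-mono (sigma n u) h = sum-mono λ i → ∑-mono (u i) λ c → h (i , c)
  ∑-mono (u ⊕ v)     h = ℕ.+-mono-≤ (∑-mono u (h ∘ inj₁)) (∑-mono v (h ∘ inj₂))

  ∑-zero : ∀ u → ∑ u (λ _ → 0) ≡ 0
  ∑-zero one         = refl
  ∑-zero (sigma n u) = ≡.trans (sum-cong λ i → ∑-zero (u i)) (sum-zero n)
  ∑-zero (u ⊕ v)     = ≡.cong₂ _+_ (∑-zero u) (∑-zero v)

  ∑-+ : ∀ u (f g : El u → ℕ) → ∑ u (λ c → f c + g c) ≡ ∑ u f + ∑ u g
  ∑-+ one         f g = refl
  ∑-+ (sigma n u) f g = ≡.trans
    (sum-cong λ i → ∑-+ (u i) (λ c → f (i , c)) (λ c → g (i , c)))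
    (sum-+ (λ i → ∑ (u i) λ c → f (i , c)) (λ i → ∑ (u i) λ c → g (i , c)))
  ∑-+ (u ⊕ v)     f g = ≡.trans (≡.cong₂ _+_ (∑-+ u _ _) (∑-+ v _ _))
    (interchange (∑ u (f ∘ inj₁)) _ _ _)

  ∑-pos : ∀ u {f : El u → ℕ} → 0 < ∑ u f → ∃ λ c → 0 < f c
  ∑-pos one         h = tt , h
  ∑-pos (sigma n u) h = let i , p = sum-pos h ; c , p′ = ∑-pos (u i) p in (i , c) , p′
  ∑-pos (u ⊕ v) {f} h with 0<+⇒ (∑ u (f ∘ inj₁)) h
  ... | inj₁ p = let c , p′ = ∑-pos u p in inj₁ c , p′
  ... | inj₂ p = let c , p′ = ∑-pos v p in inj₂ c , p′

  ∑-at-most-one : ∀ u {f : El u → ℕ} → (∀ c → f c ≤ 1) →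
    (∀ c c′ → 0 < f c → 0 < f c′ → c ≡ c′) → ∑ u f ≤ 1
  ∑-at-most-one one         h e = h tt
  ∑-at-most-one (sigma n u) h e = sum-at-most-one
    (λ i → ∑-at-most-one (u i) (λ c → h (i , c)) λ c c′ p p′ → same (e (i , c) (i , c′) p p′))
    (λ i j p p′ → let c , q = ∑-pos (u i) p ; c′ , q′ = ∑-pos (u j) p′ in
      ≡.cong proj₁ (e (i , c) (j , c′) q q′))
    where
    same : ∀ {i} {c c′ : El (u i)} → _≡_ {A = Σ (Fin n) (El ∘ u)} (i , c) (i , c′) → c ≡ c′
    same refl = refl
  ∑-at-most-one (u ⊕ v) {f} h e with ∑ u (f ∘ inj₁) in eq
  ... | zero  = ∑-at-most-one v (h ∘ inj₂) λ c c′ p p′ → inj₂-inj (e _ _ p p′)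
    where
    inj₂-inj : ∀ {c c′ : El v} → _≡_ {A = El u ⊎ El v} (inj₂ c) (inj₂ c′) → c ≡ c′
    inj₂-inj refl = refl
  ... | suc k = ℕ.≤-trans
    (ℕ.+-mono-≤ (ℕ.≤-trans (ℕ.≤-reflexive (≡.sym eq)) (∑-at-most-one u (h ∘ inj₁) λ c c′ p p′ → inj₁-inj (e _ _ p p′))) rest)
    (ℕ.≤-reflexive (ℕ.+-identityʳ 1))
    where
    inj₁-inj : ∀ {c c′ : El u} → _≡_ {A = El u ⊎ El v} (inj₁ c) (inj₁ c′) → c ≡ c′
    inj₁-inj refl = refl
    rest : ∑ v (f ∘ inj₂) ≤ 0
    rest = ≤-if-pos _ λ p →
      let c , q = ∑-pos u (≡.subst (0 <_) (≡.sym eq) (s≤s z≤n)) ; c′ , q′ = ∑-pos v p in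
      contradiction (e _ _ q q′) λ ()

  -- Double counting of incident pairs: points of the plane on one side, indices of the family on
  -- the other.
  ∑-swap : ∀ {a} {A : Set a} u (g : El u → A → ℕ) xs →
    sumᴸ (map (λ x → ∑ u λ c → g c x) xs) ≡ ∑ u λ c → sumᴸ (map (g c) xs)
  ∑-swap u g []       = ≡.sym (∑-zero u)
  ∑-swap u g (x ∷ xs) = ≡.trans (≡.cong (_ +_) (∑-swap u g xs)) (≡.sym (∑-+ u _ _))

  ∑-empty : ∀ u {f : El u → ℕ} → (∀ x → ¬ 0 < f x) → ∑ u f ≤ 0
  ∑-empty u h = ≤-if-pos _ λ p → let x , p′ = ∑-pos u p in contradiction p′ (h x)

open Sums

-- Arithmetic of a chain ring of length two.

module ChainRing {c ℓ a b} {R : Ring c ℓ} {q : ℕ} {F : FiniteField a b q}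
                 (chain : IsChainRingOfLength2 R F) where

  open Ring R public hiding (zero)
  open IsChainRingOfLength2 chain using (finite; Rad²≡0; Rad≢0; rightIdeals; residueField)
  open RingProperties R using (-‿distribˡ-*; -‿distribʳ-*; x∙y⁻¹≈ε⇒x≈y; -0#≈0#; +-cancelˡ; +-cancelʳ) public
  module F where
    open FiniteField F public
    open RingProperties ring public
  open SetoidReasoning setoid

  φ : Carrier → F.Carrier
  φ = proj₁ residueField

  private
    module φ = RingMorphisms.IsRingIsomorphism (proj₂ residueField)
    module I = Inverse F.size
    ER = finite⇒enumerated finite
    module ER = Enumerated ER

  _F≟_ : ∀ x y → Dec (x F.≈ y)
  _F≟_ = Enumerated._≟_ (finite⇒enumerated (q , F.size))

  +-minus : ∀ x y → x - y + y ≈ x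
  +-minus x y = trans (+-assoc _ _ _) (trans (+-congˡ (-‿inverseˡ y)) (+-identityʳ x))

  *-distribˡ-minus : ∀ x y z → x * (y - z) ≈ x * y - x * z
  *-distribˡ-minus x y z = trans (distribˡ x y (- z)) (+-congˡ (sym (-‿distribʳ-* x z)))

  *-distribʳ-minus : ∀ x y z → (y - z) * x ≈ y * x - z * x
  *-distribʳ-minus x y z = trans (distribʳ x y (- z)) (+-congˡ (sym (-‿distribˡ-* z x)))

  Rad-resp : ∀ {x y} → x ≈ y → Rad R x → Rad R y
  Rad-resp e h I m = Submodule.resp I e (h I m)

  φ-cong : ∀ {x y} → x ≈ y → φ x F.≈ φ y
  φ-cong e = φ.⟦⟧-cong λ I _ → Submodule.resp I (sym (trans (+-congʳ e) (-‿inverseʳ _))) (Submodule.zero∈ I)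

  φ-+ : ∀ x y → φ (x + y) F.≈ φ x F.+ φ y
  φ-+ = φ.+-homo

  φ-* : ∀ x y → φ (x * y) F.≈ φ x F.* φ y
  φ-* = φ.*-homo

  φ-- : ∀ x → φ (- x) F.≈ F.- φ x
  φ-- = φ.-‿homo

  φ-1 : φ 1# F.≈ F.1#
  φ-1 = φ.1#-homo

  φ-0 : φ 0# F.≈ F.0#
  φ-0 = φ.0#-homo

  s : F.Carrier → Carrier
  s f = proj₁ (φ.surjective f)

  φ-s : ∀ f → φ (s f) F.≈ f
  φ-s f = proj₂ (φ.surjective f) λ I _ → Submodule.resp I (sym (-‿inverseʳ _)) (Submodule.zero∈ I)

  -- The kernel of `φ` replaces `Rad R`, which quantifies over all maximal ideals; it is decidable
  -- because equality in the field is. By `Rad⇒J` and `J⇒Rad` the two agree.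
  J : Carrier → Set b
  J x = φ x F.≈ F.0#

  J-resp : ∀ {x y} → x ≈ y → J x → J y
  J-resp e h = F.trans (F.sym (φ-cong e)) h

  J-+ : ∀ {x y} → J x → J y → J (x + y)
  J-+ h h′ = F.trans (φ-+ _ _) (F.trans (F.+-cong h h′) (F.+-identityˡ _))

  J-- : ∀ {x} → J x → J (- x)
  J-- h = F.trans (φ-- _) (F.trans (F.-‿cong h) F.-0#≈0#)

  J-*ʳ : ∀ {x} y → J x → J (x * y)
  J-*ʳ y h = F.trans (φ-* _ _) (F.trans (F.*-congʳ h) (F.zeroˡ _))

  J-*ˡ : ∀ x {y} → J y → J (x * y)
  J-*ˡ x h = F.trans (φ-* _ _) (F.trans (F.*-congˡ h) (F.zeroʳ _))

  φ-minus : ∀ x y → φ (x - y) F.≈ φ x F.- φ y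
  φ-minus x y = F.trans (φ-+ x (- y)) (F.+-congˡ (φ-- y))

  φ≈⇒J : ∀ {x y} → φ x F.≈ φ y → J (x - y)
  φ≈⇒J {x} {y} e = F.trans (φ-minus x y) (F.trans (F.+-congʳ e) (F.-‿inverseʳ _))

  J⇒φ≈ : ∀ {x y} → J (x - y) → φ x F.≈ φ y
  J⇒φ≈ {x} {y} h = F.x∙y⁻¹≈ε⇒x≈y _ _ (F.trans (F.sym (φ-minus x y)) h)

  φ-+J : ∀ {x p} → J p → φ (x + p) F.≈ φ x
  φ-+J h = F.trans (φ-+ _ _) (F.trans (F.+-congˡ h) (F.+-identityʳ _))

  Rad⇒J : ∀ {x} → Rad R x → J x
  Rad⇒J {x} h = F.trans (φ.⟦⟧-cong (Rad-resp (sym (trans (+-congˡ -0#≈0#) (+-identityʳ x))) h)) φ-0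

  J⇒Rad : ∀ {x} → J x → Rad R x
  J⇒Rad {x} h = Rad-resp (trans (+-congˡ -0#≈0#) (+-identityʳ x)) (φ.injective (F.trans h (F.sym φ-0)))

  J²≈0 : ∀ {x y} → J x → J y → x * y ≈ 0#
  J²≈0 h h′ = Rad²≡0 _ _ (J⇒Rad h) (J⇒Rad h′)

  1∉J : ¬ J 1#
  1∉J h = F.1≉0 (F.trans (F.sym φ-1) h)

  private
    -- Lifting the inverse of the residue gives `x * y ≈ 1# + z` with `z` in the radical. Then
    -- `z * z ≈ 0#`, so multiplying by `1# - z` removes the error.
    rightInverse : ∀ x → ¬ J x → ∃ λ y → x * y ≈ 1#
    rightInverse x ¬Jx = y * (1# - z) , (begin
      x * (y * (1# - z))       ≈⟨ *-assoc x y _ ⟨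
      x * y * (1# - z)         ≈⟨ *-congʳ (+-minus (x * y) 1#) ⟨
      (z + 1#) * (1# - z)      ≈⟨ *-distribˡ-minus _ _ _ ⟩
      (z + 1#) * 1# - (z + 1#) * z ≈⟨ +-cong (*-identityʳ _) (-‿cong (trans (distribʳ z z 1#) (trans (+-congʳ (J²≈0 Jz Jz)) (trans (+-identityˡ _) (*-identityˡ z))))) ⟩
      z + 1# - z               ≈⟨ +-congʳ (+-comm z 1#) ⟩
      1# + z - z               ≈⟨ +-assoc _ _ _ ⟩
      1# + (z - z)             ≈⟨ +-congˡ (-‿inverseʳ z) ⟩
      1# + 0#                  ≈⟨ +-identityʳ 1# ⟩
      1#                       ∎)
      where
      y = s (proj₁ (F.inverse (φ x) ¬Jx))
      z = x * y - 1#
      Jz : J z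
      Jz = φ≈⇒J (F.trans (φ-* x y) (F.trans (F.*-congˡ (φ-s _))
        (F.trans (proj₂ (F.inverse (φ x) ¬Jx)) (F.sym φ-1))))

  -- The right inverse `y` is outside the radical too, hence has a right inverse `x″`; evaluating
  -- `x * y * x″` in two ways gives `x ≈ x″`.
  unit : ∀ x → ¬ J x → ∃ λ y → x * y ≈ 1# × y * x ≈ 1#
  unit x ¬Jx = y , xy≈1 , trans (*-congˡ x≈x″) yx″≈1
    where
    y = proj₁ (rightInverse x ¬Jx)
    xy≈1 = proj₂ (rightInverse x ¬Jx)
    ¬Jy : ¬ J y
    ¬Jy Jy = 1∉J (J-resp xy≈1 (J-*ˡ x Jy))
    x″ = proj₁ (rightInverse y ¬Jy)
    yx″≈1 = proj₂ (rightInverse y ¬Jy)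
    x≈x″ : x ≈ x″
    x≈x″ = begin
      x            ≈⟨ *-identityʳ x ⟨
      x * 1#       ≈⟨ *-congˡ yx″≈1 ⟨
      x * (y * x″) ≈⟨ *-assoc _ _ _ ⟨
      x * y * x″   ≈⟨ *-congʳ xy≈1 ⟩
      1# * x″      ≈⟨ *-identityˡ x″ ⟩
      x″           ∎

  _⁻¹⟨_⟩ : ∀ x → ¬ J x → Carrier
  x ⁻¹⟨ u ⟩ = proj₁ (unit x u)

  inverseʳ : ∀ {x} (u : ¬ J x) → x * x ⁻¹⟨ u ⟩ ≈ 1#
  inverseʳ u = proj₁ (proj₂ (unit _ u))

  inverseˡ : ∀ {x} (u : ¬ J x) → x ⁻¹⟨ u ⟩ * x ≈ 1#
  inverseˡ u = proj₂ (proj₂ (unit _ u))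

  unit-cancelˡ : ∀ {x y} → ¬ J x → x * y ≈ 0# → y ≈ 0#
  unit-cancelˡ {x} {y} u e = begin
    y                     ≈⟨ *-identityˡ y ⟨
    1# * y                ≈⟨ *-congʳ (inverseˡ u) ⟨
    x ⁻¹⟨ u ⟩ * x * y     ≈⟨ *-assoc _ _ _ ⟩
    x ⁻¹⟨ u ⟩ * (x * y)   ≈⟨ *-congˡ e ⟩
    x ⁻¹⟨ u ⟩ * 0#        ≈⟨ zeroʳ _ ⟩
    0#                    ∎

  unit-cancelʳ : ∀ {x y} → ¬ J y → x * y ≈ 0# → x ≈ 0#
  unit-cancelʳ {x} {y} u e = begin
    x                     ≈⟨ *-identityʳ x ⟨
    x * 1#                ≈⟨ *-congˡ (inverseʳ u) ⟨
    x * (y * y ⁻¹⟨ u ⟩)   ≈⟨ *-assoc _ _ _ ⟨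
    x * y * y ⁻¹⟨ u ⟩     ≈⟨ *-congʳ e ⟩
    0# * y ⁻¹⟨ u ⟩        ≈⟨ zeroˡ _ ⟩
    0#                    ∎

  π : Carrier
  π = proj₁ Rad≢0

  Jπ : J π
  Jπ = Rad⇒J (proj₁ (proj₂ Rad≢0))

  π≉0 : ¬ π ≈ 0#
  π≉0 = proj₂ (proj₂ Rad≢0)

  -- A unit `x` could be cancelled, which would give `π ≈ 0#`.
  π*-zero⇒J : ∀ {x} → π * x ≈ 0# → J x
  π*-zero⇒J {x} e = decidable-stable (φ x F≟ F.0#) λ u → π≉0 (unit-cancelʳ u e)

  private
    πMultiple? : ∀ x → Dec (∃ λ r → x ≈ π * r)
    πMultiple? x = any? ER (λ e h → trans h (*-congˡ e)) (λ r → x ER.≟ (π * r))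

    πR : RightIdeal R
    πR = record
      { member = λ x → isYes (πMultiple? x)
      ; resp   = λ e h → let r , z = toWitness h in fromWitness (r , trans (sym e) z)
      ; zero∈  = fromWitness (0# , sym (zeroʳ π))
      ; +∈     = λ h h′ → let r , z = toWitness h ; r′ , z′ = toWitness h′ in
                   fromWitness (r + r′ , trans (+-cong z z′) (sym (distribˡ π r r′)))
      ; *∈     = λ t h → let r , z = toWitness h in
                   fromWitness (r * t , trans (*-congʳ z) (*-assoc π r t))
      }

  -- By the chain condition `πR` is the whole ring, the radical or zero. It lies inside the radical,
  -- so it is not the whole ring, and it contains `π`, so it is not zero.
  J⊆πR : ∀ {x} → J x → ∃ λ r → x ≈ π * r
  J⊆πR Jx with rightIdeals πR
  ... | inj₁ (_ , all) =
    let r , e = toWitness (all {1#} _) in contradiction (J-resp (sym e) (J-*ʳ r Jπ)) 1∉J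
  ... | inj₂ (inj₁ (_ , rad)) = toWitness (rad (J⇒Rad Jx))
  ... | inj₂ (inj₂ (zeroI , _)) = contradiction (zeroI (fromWitness (1# , sym (*-identityʳ π)))) π≉0

  private
    d : Fin q → F.Carrier
    d = I.from

    d-injective : ∀ {i j} → d i F.≈ d j → i ≡ j
    d-injective {i} {j} e = ≡.trans (≡.sym (I.strictlyInverseˡ i)) (≡.trans (I.to-cong e) (I.strictlyInverseˡ j))

  -- `S` is an arbitrary lift of the residues and `P` a family in the radical; `S i + P j` serves as
  -- a two-digit expansion.
  S P : Fin q → Carrier
  S i = s (d i)
  P i = π * S i

  index : Carrier → Fin q
  index x = I.to (φ x)

  φ-S-index : ∀ x → φ (S (index x)) F.≈ φ x
  φ-S-index x = F.trans (φ-s _) (I.strictlyInverseʳ (φ x))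

  JP : ∀ i → J (P i)
  JP i = J-*ʳ _ Jπ

  S-injective : ∀ {i j} → φ (S i) F.≈ φ (S j) → i ≡ j
  S-injective e = d-injective (F.trans (F.sym (φ-s _)) (F.trans e (φ-s _)))

  P-injective : ∀ {i j} → P i ≈ P j → i ≡ j
  P-injective {i} {j} e = S-injective (J⇒φ≈ (π*-zero⇒J (trans (*-distribˡ-minus π _ _)
    (trans (+-congʳ e) (-‿inverseʳ _)))))

-- Indicators and sums over lists.

⟦_⟧ : Bool → ℕ
⟦ b ⟧ = if b then 1 else 0

⟦⟧≤1 : ∀ b → ⟦ b ⟧ ≤ 1
⟦⟧≤1 true  = s≤s z≤n
⟦⟧≤1 false = z≤n

0<⟦⟧⇒T : ∀ b → 0 < ⟦ b ⟧ → T b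
0<⟦⟧⇒T true _ = _

T⇒1≤⟦⟧ : ∀ b → T b → 1 ≤ ⟦ b ⟧
T⇒1≤⟦⟧ true _ = s≤s z≤n

⟦⟧-cong : ∀ b b′ → (T b → T b′) → (T b′ → T b) → ⟦ b ⟧ ≡ ⟦ b′ ⟧
⟦⟧-cong true  true  f g = ≡.refl
⟦⟧-cong true  false f g = contradiction (f _) λ ()
⟦⟧-cong false true  f g = contradiction (g _) λ ()
⟦⟧-cong false false f g = ≡.refl

module _ {a} {A : Set a} (f : A → ℕ) where

  sumᴸ-zero : ∀ {xs} → All (λ x → f x ≡ 0) xs → sumᴸ (map f xs) ≡ 0
  sumᴸ-zero []       = ≡.refl
  sumᴸ-zero (e ∷ es) = ≡.cong₂ ℕ._+_ e (sumᴸ-zero es)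

  1≤sumᴸ : ∀ {xs} → Any (λ x → 1 ≤ f x) xs → 1 ≤ sumᴸ (map f xs)
  1≤sumᴸ (here p)         = ℕ.≤-trans p (ℕ.m≤m+n _ _)
  1≤sumᴸ (there {x} {xs} p) = ℕ.≤-trans (1≤sumᴸ p) (ℕ.m≤n+m _ (f x))

  sumᴸ≤1 : (∀ x → f x ≤ 1) → ∀ {xs} → AllPairs (λ x y → ¬ (0 < f x × 0 < f y)) xs →
    sumᴸ (map f xs) ≤ 1
  sumᴸ≤1 f≤1 []             = z≤n
  sumᴸ≤1 f≤1 {x ∷ xs} (d ∷ ds) with f x in eq
  ... | zero  = sumᴸ≤1 f≤1 ds
  ... | suc k = ℕ.≤-trans (ℕ.+-mono-≤ (≡.subst (_≤ 1) eq (f≤1 x)) (ℕ.≤-reflexive rest)) (ℕ.≤-reflexive (ℕ.+-identityʳ 1))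
    where
    rest : sumᴸ (map f xs) ≡ 0
    rest = sumᴸ-zero (All.map (λ ¬p → ℕ.n≤0⇒n≡0 (ℕ.≮⇒≥ λ p → ¬p (s≤s z≤n , p))) d)

  sumᴸ-filter-≤ : ∀ {p} {P : Pred A p} (P? : Decidable P) xs → sumᴸ (map f (filter P? xs)) ≤ sumᴸ (map f xs)
  sumᴸ-filter-≤ P? []       = z≤n
  sumᴸ-filter-≤ P? (x ∷ xs) with P? x
  ... | yes _ = ℕ.+-monoʳ-≤ (f x) (sumᴸ-filter-≤ P? xs)
  ... | no  _ = ℕ.≤-trans (sumᴸ-filter-≤ P? xs) (ℕ.m≤n+m _ (f x))

-- Points from normalised vectors, and arcs from families of vectors.

module Geometry {c ℓ a b} {R : Ring c ℓ} {q : ℕ} {F : FiniteField a b q}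
                (chain : IsChainRingOfLength2 R F) where

  open ChainRing chain public
  open PHG R (IsChainRingOfLength2.finite chain)
  open RightModule R³ using (Carrierᴹ; _≈ᴹ_; _*ᵣ_; +ᴹ-identityʳ; ≈ᴹ-trans; ≈ᴹ-sym; ≈ᴹ-refl; *ᵣ-assoc; *ᵣ-cong; *ᵣ-identityʳ; 0ᴹ)
  private
    ER = finite⇒enumerated (IsChainRingOfLength2.finite chain)
    module Span = FreeSubmodules R³ ER (ER ×-enumerated (ER ×-enumerated ER))

  infix 4 _∈ᴾ_
  _∈ᴾ_ : Carrierᴹ → ∀ {r} → Σ (Submodule R³) (IsFree r) → Set
  v ∈ᴾ (N , _) = T (Submodule.member N v)

  generator : Point → Carrierᴹ
  generator (_ , w , _) = w zero

  generated : ∀ N {v} → v ∈ᴾ N → ∃ λ t → v ≈ᴹ generator N *ᵣ t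
  generated (N , w , _ , spans) {v} h =
    let t , e = Equivalence.to (spans v) h in t zero , ≈ᴹ-trans e (+ᴹ-identityʳ _)

  generates : ∀ N t {v} → v ≈ᴹ generator N *ᵣ t → v ∈ᴾ N
  generates (N , w , _ , spans) t {v} e =
    Equivalence.from (spans v) ((λ _ → t) , ≈ᴹ-trans e (≈ᴹ-sym (+ᴹ-identityʳ _)))

  -- A coordinate equal to 1 makes the vector independent, and any scalar that produces the vector
  -- from another one is a unit.
  Normalised : Carrierᴹ → Set ℓ
  Normalised (x , y , z) = x ≈ 1# ⊎ y ≈ 1# ⊎ z ≈ 1#

  normalised-cancel : ∀ {v} t → Normalised v → v *ᵣ t ≈ᴹ 0ᴹ → t ≈ 0#
  normalised-cancel t (inj₁ e)        (h , _)     = trans (sym (trans (*-congʳ e) (*-identityˡ t))) h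
  normalised-cancel t (inj₂ (inj₁ e)) (_ , h , _) = trans (sym (trans (*-congʳ e) (*-identityˡ t))) h
  normalised-cancel t (inj₂ (inj₂ e)) (_ , _ , h) = trans (sym (trans (*-congʳ e) (*-identityˡ t))) h

  normalised-unit : ∀ {v} w t → Normalised v → v ≈ᴹ w *ᵣ t → ¬ J t
  normalised-unit w t (inj₁ e)        (h , _)     Jt = 1∉J (J-resp (trans (sym h) e) (J-*ˡ _ Jt))
  normalised-unit w t (inj₂ (inj₁ e)) (_ , h , _) Jt = 1∉J (J-resp (trans (sym h) e) (J-*ˡ _ Jt))
  normalised-unit w t (inj₂ (inj₂ e)) (_ , _ , h) Jt = 1∉J (J-resp (trans (sym h) e) (J-*ˡ _ Jt))

  ⟨_⟩ : ∀ v → Normalised v → Point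
  ⟨ v ⟩ nv = Span.span (λ _ → v) , (λ _ → v) ,
    (λ { s e zero → normalised-cancel (s zero) nv (≈ᴹ-trans (≈ᴹ-sym (+ᴹ-identityʳ _)) e) }) ,
    Span.span-spans (λ _ → v)

  -- The scalar taking the generator to `v` is invertible by `normalised-unit`, so `v` generates the
  -- point as well.
  generator-multiple : ∀ N {v} → Normalised v → v ∈ᴾ N → ∃ λ t → generator N ≈ᴹ v *ᵣ t
  generator-multiple N {v} nv h = u , ≈ᴹ-sym (≈ᴹ-trans (*ᵣ-cong e refl)
    (≈ᴹ-trans (*ᵣ-assoc w t u) (≈ᴹ-trans (*ᵣ-cong {w} ≈ᴹ-refl (inverseʳ ¬Jt)) (*ᵣ-identityʳ w))))
    where
    w = generator N
    t = proj₁ (generated N h)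
    e = proj₂ (generated N h)
    ¬Jt = normalised-unit w t nv e
    u = t ⁻¹⟨ ¬Jt ⟩

  proportional : ∀ N {v v′} → Normalised v → v ∈ᴾ N → v′ ∈ᴾ N → ∃ λ t → v′ ≈ᴹ v *ᵣ t
  proportional N {v} nv h h′ =
    let t , e = generator-multiple N nv h ; t′ , e′ = generated N h′ in
    t * t′ , ≈ᴹ-trans e′ (≈ᴹ-trans (*ᵣ-cong e refl) (*ᵣ-assoc v t t′))

  multiple∈ : ∀ {r} (N : Σ (Submodule R³) (IsFree r)) {v} t → v ∈ᴾ N → v *ᵣ t ∈ᴾ N
  multiple∈ (N , _) t h = Submodule.*∈ N t h

  point⊆ : ∀ N {r} (L : Σ (Submodule R³) (IsFree r)) {v} → Normalised v → v ∈ᴾ N → v ∈ᴾ L →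
    proj₁ N ⊆ proj₁ L
  point⊆ N L {v} nv h h′ x x∈N =
    let t , e = proportional N nv h x∈N in
    Submodule.resp (proj₁ L) (≈ᴹ-sym e) (multiple∈ L t h′)

  incidence : ∀ {r} → Carrierᴹ → Σ (Submodule R³) (IsFree r) → ℕ
  incidence v (N , _) = ⟦ Submodule.member N v ⟧

  incidence≤1 : ∀ v {r} (N : Σ (Submodule R³) (IsFree r)) → incidence v N ≤ 1
  incidence≤1 v N = ⟦⟧≤1 _

  -- At least one, because `⟨ v ⟩ nv` occurs in the complete list; at most one, because by `point⊆`
  -- points sharing `v` coincide and the list is free of repetitions.
  one-point : ∀ v → Normalised v → sumᴸ (map (incidence v) points) ≡ 1
  one-point v nv = ℕ.≤-antisym
    (sumᴸ≤1 (incidence v) (incidence≤1 v) (allPairs-map points-unique))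
    (1≤sumᴸ (incidence v) (Any.map
      (λ {N} (f , _) → T⇒1≤⟦⟧ _ (f v (generates (⟨ v ⟩ nv) 1# {v} (≈ᴹ-sym (*ᵣ-identityʳ v)))))
      (points-complete (⟨ v ⟩ nv))))
    where
    allPairs-map : ∀ {xs} → AllPairs (λ N N′ → ¬ (proj₁ N ≋ proj₁ N′)) xs →
      AllPairs (λ N N′ → ¬ (0 < incidence v N × 0 < incidence v N′)) xs
    allPairs-map = AllPairs.map λ {N} {N′} ne (h , h′) →
      let i = 0<⟦⟧⇒T _ h ; i′ = 0<⟦⟧⇒T _ h′ in ne (point⊆ N N′ nv i i′ , point⊆ N′ N nv i′ i)

  module _ (u : Shape) (vec : El u → Carrierᴹ) (normalised : ∀ x → Normalised (vec x))
           (distinct : ∀ x y t → vec y ≈ᴹ vec x *ᵣ t → x ≡ y) where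

    private
      K : Multiset
      K = record
        { to   = λ N → ∑ u λ x → incidence (vec x) N
        ; cong = λ (f , g) → ∑-cong u λ x → ⟦⟧-cong _ _ (f (vec x)) (g (vec x))
        }

      K≤1 : ∀ N → ∑ u (λ x → incidence (vec x) N) ≤ 1
      K≤1 N = ∑-at-most-one u (λ x → incidence≤1 (vec x) N) λ x y h h′ →
        let t , e = proportional N (normalised x) (0<⟦⟧⇒T _ h) (0<⟦⟧⇒T _ h′) in distinct x y t e

      K-projective : IsProjective K
      K-projective N with ∑ u (λ x → incidence (vec x) N) | K≤1 N
      ... | zero        | _       = inj₁ ≡.refl
      ... | suc zero    | _       = inj₂ ≡.refl
      ... | suc (suc _) | s≤s ()

      total-K : total K ≡ size u
      total-K = ≡.trans (∑-swap u (λ x → incidence (vec x)) points)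
        (∑-cong u λ x → one-point (vec x) (normalised x))

      -- After exchanging the sums, each vector lies in one point only, and it contributes nothing
      -- unless it belongs to `L`, since the points on `L` are submodules of `L`.
      onLine-K : ∀ L → onLine K L ≤ ∑ u λ x → incidence (vec x) L
      onLine-K L = ℕ.≤-trans (ℕ.≤-reflexive (∑-swap u (λ x → incidence (vec x)) (filter (_on? L) points)))
        (∑-mono u λ x → ≤-if-pos _ (bound x))
        where
        bound : ∀ x → 0 < sumᴸ (map (incidence (vec x)) (filter (_on? L) points)) →
                sumᴸ (map (incidence (vec x)) (filter (_on? L) points)) ≤ incidence (vec x) L
        bound x pos with Submodule.member (proj₁ L) (vec x) in eq
        ... | true  = ℕ.≤-trans (sumᴸ-filter-≤ (incidence (vec x)) (_on? L) points)
          (ℕ.≤-reflexive (one-point (vec x) (normalised x)))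
        ... | false = ℕ.≤-reflexive (sumᴸ-zero (incidence (vec x))
          (All.map (λ {N} N⊆L → ℕ.n≤0⇒n≡0 (ℕ.≮⇒≥ λ p → ≡.subst T eq (N⊆L (vec x) (0<⟦⟧⇒T _ p))))
            (All.all-filter (_on? L) points)))

    -- Reduces the construction of an arc to counting, for each line, the vectors of the family that
    -- it contains.
    projectiveArc : ∀ {n} → (∀ L → ∑ u (λ x → incidence {2} (vec x) L) ≤ n) → ProjectiveArc (size u) n
    projectiveArc load = K , (total-K , λ L → ℕ.≤-trans (onLine-K L) (load L)) , K-projective

-- Equations of lines.

module Lines {c ℓ a b} {R : Ring c ℓ} {q : ℕ} {F : FiniteField a b q}
                (chain : IsChainRingOfLength2 R F) where

  open Geometry chain hiding (s)
  open PHG R (IsChainRingOfLength2.finite chain)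
  open RightModule R³ using (Carrierᴹ; _≈ᴹ_)
  open SetoidReasoning setoid
  open CommutativeSemigroup (CommutativeMonoid.commutativeSemigroup +-commutativeMonoid) using (interchange)

  -- The affine points are `(1# , x , y)`. The cases are lines with a slope, lines neighbouring a
  -- vertical line, and lines neighbouring the line at infinity. Coefficients stand on the left
  -- because lines are right submodules. Each equation is recorded as a necessary condition, which
  -- is what upper bounds on incidences call for.
  data LineEquation (L : Line) : Set (c Level.⊔ ℓ Level.⊔ b) where
    graph    : ∀ m h → (∀ {x y z} → (x , y , z) ∈ᴾ L → z ≈ m * y + h * x) → LineEquation L
    vertical : ∀ h p → J p → (∀ {x y z} → (x , y , z) ∈ᴾ L → y ≈ h * x + p * z) → LineEquation L
    infinite : ∀ p p′ → J p → J p′ → (∀ {x y z} → (x , y , z) ∈ᴾ L → x ≈ p * y + p′ * z) → LineEquation L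

  private
    solveʳ : ∀ {x y z a b} (u : ¬ J b) → x ≈ a * y + b * z →
             z ≈ - (b ⁻¹⟨ u ⟩ * a) * y + b ⁻¹⟨ u ⟩ * x
    solveʳ {x} {y} {z} {a} {b} u e = sym (begin
      - (b⁻¹ * a) * y + b⁻¹ * x                       ≈⟨ +-cong (sym (-‿distribˡ-* _ _)) (*-congˡ e) ⟩
      - (b⁻¹ * a * y) + b⁻¹ * (a * y + b * z)         ≈⟨ +-congˡ (distribˡ _ _ _) ⟩
      - (b⁻¹ * a * y) + (b⁻¹ * (a * y) + b⁻¹ * (b * z)) ≈⟨ +-congˡ (+-cong (*-assoc _ _ _) (*-assoc _ _ _)) ⟨
      - (b⁻¹ * a * y) + (b⁻¹ * a * y + b⁻¹ * b * z)   ≈⟨ +-assoc _ _ _ ⟨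
      - (b⁻¹ * a * y) + b⁻¹ * a * y + b⁻¹ * b * z     ≈⟨ +-cong (-‿inverseˡ _) (trans (*-congʳ (inverseˡ u)) (*-identityˡ z)) ⟩
      0# + z                                          ≈⟨ +-identityˡ z ⟩
      z                                               ∎)
      where b⁻¹ = b ⁻¹⟨ u ⟩

    solveˡ : ∀ {x y z a b} (u : ¬ J a) → x ≈ a * y + b * z →
             y ≈ a ⁻¹⟨ u ⟩ * x + - (a ⁻¹⟨ u ⟩ * b) * z
    solveˡ u e = trans (solveʳ u (trans e (+-comm _ _))) (+-comm _ _)

  module _ (L : Line) where

    private
      w = proj₁ (proj₂ L)
      independent = proj₁ (proj₂ (proj₂ L))
      spans = proj₂ (proj₂ (proj₂ L))

      coordinate : Carrierᴹ → Fin 3 → Carrier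
      coordinate (x , y , z) 0F = x
      coordinate (x , y , z) 1F = y
      coordinate (x , y , z) 2F = z

      u v : Fin 3 → Carrier
      u = coordinate (w 0F)
      v = coordinate (w 1F)

      u-v-independent : ∀ σ τ → (∀ i → u i * σ + v i * τ ≈ 0#) → σ ≈ 0# × τ ≈ 0#
      u-v-independent σ τ e = z 0F , z 1F
        where
        s : Fin 2 → Carrier
        s 0F = σ
        s 1F = τ
        e′ : ∀ i → u i * σ + (v i * τ + 0#) ≈ 0#
        e′ i = trans (+-congˡ (+-identityʳ _)) (e i)
        z = independent s (e′ 0F , e′ 1F , e′ 2F)

      coefficients : ∀ {x} → x ∈ᴾ L → ∃₂ λ σ τ → ∀ i → coordinate x i ≈ u i * σ + v i * τ
      coefficients {x} h = let s , e₀ , e₁ , e₂ = Equivalence.to (spans x) h in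
        s 0F , s 1F , λ { 0F → drop0 e₀ ; 1F → drop0 e₁ ; 2F → drop0 e₂ }
        where
        drop0 : ∀ {x y z} → x ≈ y + (z + 0#) → x ≈ y + z
        drop0 e = trans e (+-congˡ (+-identityʳ _))

      -- If all coordinates of `u` were in the radical, multiplication by `π` would annihilate `u`,
      -- against independence.
      pivot₁ : ∃ λ i → ¬ J (u i)
      pivot₁ = Fin.¬∀⟶∃¬ 3 _ (λ i → φ (u i) F≟ F.0#) λ Ju →
        π≉0 (proj₁ (u-v-independent π 0# λ i →
          trans (+-cong (J²≈0 (Ju i) Jπ) (zeroʳ _)) (+-identityʳ 0#)))

      i = proj₁ pivot₁
      uᵢ⁻¹ = u i ⁻¹⟨ proj₂ pivot₁ ⟩

      -- Gaussian elimination: the multiple of `u` is chosen to clear coordinate `i`.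
      v′ : Fin 3 → Carrier
      v′ j = v j - u j * (uᵢ⁻¹ * v i)

      v′ᵢ≈0 : v′ i ≈ 0#
      v′ᵢ≈0 = trans (+-congˡ (-‿cong (trans (sym (*-assoc _ _ _))
        (trans (*-congʳ (inverseʳ (proj₂ pivot₁))) (*-identityˡ _))))) (-‿inverseʳ _)

      -- If all of `v′` were in the radical, `v′` times `π` would vanish, a relation between `u` and
      -- `v` in which `v` has the nonzero coefficient `π`.
      pivot₂ : ∃ λ j → ¬ J (v′ j)
      pivot₂ = Fin.¬∀⟶∃¬ 3 _ (λ j → φ (v′ j) F≟ F.0#) λ Jv′ →
        π≉0 (proj₂ (u-v-independent (- (uᵢ⁻¹ * v i * π)) π λ j → begin
          u j * - (uᵢ⁻¹ * v i * π) + v j * π     ≈⟨ +-comm _ _ ⟩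
          v j * π + u j * - (uᵢ⁻¹ * v i * π)     ≈⟨ +-congˡ (-‿distribʳ-* _ _) ⟨
          v j * π - u j * (uᵢ⁻¹ * v i * π)       ≈⟨ +-congˡ (-‿cong (*-assoc _ _ _)) ⟨
          v j * π - u j * (uᵢ⁻¹ * v i) * π       ≈⟨ *-distribʳ-minus _ _ _ ⟨
          v′ j * π                               ≈⟨ J²≈0 (Jv′ j) Jπ ⟩
          0#                                     ∎))

      j = proj₁ pivot₂
      v′ⱼ⁻¹ = v′ j ⁻¹⟨ proj₂ pivot₂ ⟩

      module _ (k : Fin 3) where

        -- Coordinate `k` is to be the combination `α` times coordinate `j` plus `β` times
        -- coordinate `i`. As `v′ i` vanishes, `v′` forces `α`; then `u` forces `β`.
        α β : Carrier
        α = v′ k * v′ⱼ⁻¹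
        β = (u k - α * u j) * uᵢ⁻¹

        u-equation : u k ≈ α * u j + β * u i
        u-equation = sym (begin
          α * u j + β * u i                   ≈⟨ +-comm _ _ ⟩
          β * u i + α * u j                   ≈⟨ +-congʳ (trans (*-assoc _ _ _) (trans (*-congˡ (inverseˡ (proj₂ pivot₁))) (*-identityʳ _))) ⟩
          u k - α * u j + α * u j             ≈⟨ +-minus _ _ ⟩
          u k                                 ∎)

        v-equation : v k ≈ α * v j + β * v i
        v-equation = sym (begin
          α * v j + β * v i                                ≈⟨ +-congˡ (*-assoc _ _ _) ⟩
          α * v j + (u k - α * u j) * t                    ≈⟨ +-congˡ (*-distribʳ-minus _ _ _) ⟩
          α * v j + (u k * t - α * u j * t)                ≈⟨ +-congˡ (+-comm _ _) ⟩
          α * v j + (- (α * u j * t) + u k * t)            ≈⟨ +-assoc _ _ _ ⟨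
          α * v j - α * u j * t + u k * t                  ≈⟨ +-congʳ (+-congˡ (-‿cong (*-assoc _ _ _))) ⟩
          α * v j - α * (u j * t) + u k * t                ≈⟨ +-congʳ (*-distribˡ-minus _ _ _) ⟨
          α * v′ j + u k * t                               ≈⟨ +-congʳ (trans (*-assoc _ _ _) (trans (*-congˡ (inverseˡ (proj₂ pivot₂))) (*-identityʳ _))) ⟩
          v′ k + u k * t                                   ≈⟨ +-minus _ _ ⟩
          v k                                              ∎)
          where t = uᵢ⁻¹ * v i

        equation : ∀ {x} → x ∈ᴾ L → coordinate x k ≈ α * coordinate x j + β * coordinate x i
        equation h = let σ , τ , e = coefficients h in begin
          _                                                            ≈⟨ e k ⟩
          u k * σ + v k * τ                                            ≈⟨ +-cong (*-congʳ u-equation) (*-congʳ v-equation) ⟩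
          (α * u j + β * u i) * σ + (α * v j + β * v i) * τ            ≈⟨ +-cong (distribʳ _ _ _) (distribʳ _ _ _) ⟩
          (α * u j * σ + β * u i * σ) + (α * v j * τ + β * v i * τ)    ≈⟨ interchange _ _ _ _ ⟩
          (α * u j * σ + α * v j * τ) + (β * u i * σ + β * v i * τ)    ≈⟨ +-cong (+-cong (*-assoc _ _ _) (*-assoc _ _ _)) (+-cong (*-assoc _ _ _) (*-assoc _ _ _)) ⟩
          (α * (u j * σ) + α * (v j * τ)) + (β * (u i * σ) + β * (v i * τ)) ≈⟨ +-cong (distribˡ _ _ _) (distribˡ _ _ _) ⟨
          α * (u j * σ + v j * τ) + β * (u i * σ + v i * τ)            ≈⟨ +-cong (*-congˡ (e j)) (*-congˡ (e i)) ⟨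
          _                                                            ∎

      from-z : ∀ {m h} → (∀ {x y z} → (x , y , z) ∈ᴾ L → z ≈ m * y + h * x) → LineEquation L
      from-z = graph _ _

      from-y : ∀ {m h} → (∀ {x y z} → (x , y , z) ∈ᴾ L → y ≈ m * z + h * x) → LineEquation L
      from-y {m} {h} e with φ m F≟ F.0#
      ... | yes Jm = vertical h m Jm λ ∈L → trans (e ∈L) (+-comm _ _)
      ... | no  u  = graph _ _ λ ∈L → solveˡ u (e ∈L)

      -- A unit coefficient of `z` gives a graph; failing that, a unit coefficient of `y` gives a
      -- vertical equation. With both in the radical the line is close to the line at infinity.
      from-x : ∀ {m h} → (∀ {x y z} → (x , y , z) ∈ᴾ L → x ≈ m * y + h * z) → LineEquation L
      from-x {m} {h} e with φ h F≟ F.0#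
      ... | no  u  = graph _ _ λ ∈L → solveʳ u (e ∈L)
      ... | yes Jh with φ m F≟ F.0#
      ...   | yes Jm = infinite m h Jm Jh e
      ...   | no  u  = vertical _ _ (J-- (J-*ˡ _ Jh)) λ ∈L → solveˡ u (e ∈L)

    lineEquation : LineEquation L
    -- The pivots differ because `v′` vanishes at `i` but is a unit at `j`. In `go` they are
    -- variables, so that they can be matched on.
    lineEquation = go i j (λ e → proj₂ pivot₂ (≡.subst (λ k → J (v′ k)) e (J-resp (sym v′ᵢ≈0) φ-0))) equation
      where
      go : ∀ i j → ¬ i ≡ j → (∀ k {x} → x ∈ᴾ L → coordinate x k ≈ α k * coordinate x j + β k * coordinate x i) → LineEquation L
      go 0F 0F d e = contradiction ≡.refl d
      go 0F 1F d e = from-z (e 2F)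
      go 0F 2F d e = from-y (e 1F)
      go 1F 0F d e = from-z λ ∈L → trans (e 2F ∈L) (+-comm _ _)
      go 1F 1F d e = contradiction ≡.refl d
      go 1F 2F d e = from-x λ ∈L → trans (e 0F ∈L) (+-comm _ _)
      go 2F 0F d e = from-y λ ∈L → trans (e 1F ∈L) (+-comm _ _)
      go 2F 1F d e = from-x (e 0F)
      go 2F 2F d e = contradiction ≡.refl d

-- The point set and its intersections with lines.

-- X is the image of ξ.  The class at infinity of slope ξ i receives a grid of q - 2 = r + t segments
-- of width i points, the vertical class at infinity one of apexHeight segments of apexWidth points,
-- all the segments being parallel to the line at infinity.
module Construction {c ℓ a b} {R : Ring c ℓ} (r t : ℕ) {F : FiniteField a b (r ℕ.+ (2 ℕ.+ t))}
                    (chain : IsChainRingOfLength2 R F)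
                    (width : Fin r → ℕ) (width≤q : ∀ i → width i ≤ r ℕ.+ (2 ℕ.+ t))
                    (apexWidth apexHeight : ℕ) (apexWidth≤q : apexWidth ≤ r ℕ.+ (2 ℕ.+ t)) (apexHeight≤t : apexHeight ≤ t)
                    where

  open Geometry chain
  open Lines chain
  open PHG R (IsChainRingOfLength2.finite chain)
  open RightModule R³ using (Carrierᴹ; _≈ᴹ_; _*ᵣ_)

  q n : ℕ
  q = r ℕ.+ (2 ℕ.+ t)
  n = 2 ℕ.* q ℕ.+ t

  r+t≤q : r ℕ.+ t ≤ q
  r+t≤q = ℕ.+-monoʳ-≤ r (ℕ.m≤n+m t 2)

  apexHeight≤q : apexHeight ≤ q
  apexHeight≤q = ℕ.≤-trans apexHeight≤t (ℕ.≤-trans (ℕ.m≤n+m t r) r+t≤q)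

  ξ : Fin r → Fin q
  ξ i = i ↑ˡ (2 ℕ.+ t)

  η : Fin (2 ℕ.+ t) → Fin q
  η j = r ↑ʳ j

  data Split (i : Fin q) : Set where
    left  : ∀ k → ξ k ≡ i → Split i
    right : ∀ k → η k ≡ i → Split i

  split : ∀ i → Split i
  split i with splitAt r i in eq
  ... | inj₁ k = left k (Fin.splitAt⁻¹-↑ˡ eq)
  ... | inj₂ k = right k (Fin.splitAt⁻¹-↑ʳ eq)

  ξ≢η : ∀ {i j} → ξ i ≢ η j
  ξ≢η {i} {j} e with ≡.trans (≡.sym (Fin.splitAt-↑ˡ r i (2 ℕ.+ t))) (≡.trans (≡.cong (splitAt r) e) (Fin.splitAt-↑ʳ r (2 ℕ.+ t) j))
  ... | ()

  -- Offsets of the two parallel segments in a class outside X.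
  E : Fin 2 → Carrier
  E 0F = 0#
  E 1F = π

  JE : ∀ e → J (E e)
  JE 0F = φ-0
  JE 1F = Jπ

  E-injective : ∀ {e e′} → E e ≈ E e′ → e ≡ e′
  E-injective {0F} {0F} h = ≡.refl
  E-injective {0F} {1F} h = contradiction (sym h) π≉0
  E-injective {1F} {0F} h = contradiction h π≉0
  E-injective {1F} {1F} h = ≡.refl

  digits-injective : ∀ {i j p p′} → J p → J p′ → S i + p ≈ S j + p′ → i ≡ j × p ≈ p′
  digits-injective {i} {j} Jp Jp′ e with S-injective (F.trans (F.sym (φ-+J Jp)) (F.trans (φ-cong e) (φ-+J Jp′)))
  ... | ≡.refl = ≡.refl , +-cancelˡ (S i) _ _ e

  J-double : ∀ j e x → J (S (η j) * P x + E e)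
  J-double j e x = J-+ (J-*ˡ _ (JP x)) (JE e)

  doubles singles sides apex shape : Shape
  doubles = sigma (2 ℕ.+ t) λ _ → sigma q λ _ → sigma 2 λ _ → sigma q λ _ → one
  singles = sigma r λ _ → sigma q λ _ → sigma q λ _ → one
  sides   = sigma r λ i → sigma (r ℕ.+ t) λ _ → sigma (width i) λ _ → one
  apex    = sigma apexHeight λ _ → sigma apexWidth λ _ → one
  shape   = doubles ⊕ singles ⊕ sides ⊕ apex

  -- In `doubles` the segment `e` of the class `(η j , y)` has slope `S (η j)` and is parametrised
  -- by `x`. In `singles` the segment is vertical, shifted by `π * (S y * S y)` and parametrised by
  -- `y′`. In `sides` and `apex` the index `v` selects a segment and `u` a position on it.
  vec : El shape → Carrierᴹ
  vec (inj₁ (j , y , e , x , _))        = 1# , S (η j) + P x , S y + (S (η j) * P x + E e)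
  vec (inj₂ (inj₁ (i , y , y′ , _)))    = 1# , S (ξ i) + π * (S y * S y) , S y + P y′
  vec (inj₂ (inj₂ (inj₁ (i , v , u , _)))) = P (inject≤ v r+t≤q) , 1# , S (ξ i) + P (inject≤ u (width≤q i))
  vec (inj₂ (inj₂ (inj₂ (v , u , _))))  = P (inject≤ v apexHeight≤q) , P (inject≤ u apexWidth≤q) , 1#

  normalised : ∀ x → Normalised (vec x)
  normalised (inj₁ _)               = inj₁ refl
  normalised (inj₂ (inj₁ _))        = inj₁ refl
  normalised (inj₂ (inj₂ (inj₁ _))) = inj₂ (inj₁ refl)
  normalised (inj₂ (inj₂ (inj₂ _))) = inj₂ (inj₂ refl)

  private
    unscale : ∀ {k x y} → 1# ≈ 1# * k → y ≈ x * k → x ≈ y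
    unscale {k} {x} e h = sym (trans h (trans (*-congˡ (sym (trans e (*-identityˡ k)))) (*-identityʳ x)))

    J-factor : ∀ {k p} → J p → p ≈ 1# * k → J k
    J-factor Jp e = J-resp (trans e (*-identityˡ _)) Jp

    non-unit : ∀ {k p} → J p → ¬ 1# ≈ p * k
    non-unit Jp e = 1∉J (J-resp (sym e) (J-*ʳ _ Jp))

  η-injective : ∀ {j j′} → η j ≡ η j′ → j ≡ j′
  η-injective = Fin.↑ʳ-injective r _ _

  ξ-injective : ∀ {i i′} → ξ i ≡ ξ i′ → i ≡ i′
  ξ-injective = Fin.↑ˡ-injective (2 ℕ.+ t) _ _

  J-square : ∀ y → J (π * (S y * S y))
  J-square y = J-*ʳ _ Jπ

  -- Within a family the coordinate 1 forces the scalar to be 1, and the indices are read off as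
  -- digits. The affine families differ in the residue of the second coordinate, outside or inside
  -- X; the other pairs differ in which coordinates are units.
  distinct : ∀ x y k → vec y ≈ᴹ vec x *ᵣ k → x ≡ y
  distinct (inj₁ (j , y , e , x , _)) (inj₁ (j′ , y′ , e′ , x′ , _)) k (e₀ , e₁ , e₂)
    with η≡ , h₁ ← digits-injective (JP x) (JP x′) (unscale e₀ e₁)
    with ≡.refl ← η-injective η≡
    with ≡.refl ← P-injective h₁
    with ≡.refl , h₂ ← digits-injective (J-double j e x) (J-double j e′ x) (unscale e₀ e₂)
    with ≡.refl ← E-injective {e} {e′} (+-cancelˡ _ _ _ h₂) = ≡.refl
  distinct (inj₁ (j , y , e , x , _)) (inj₂ (inj₁ (i , y′ , z , _))) k (e₀ , e₁ , _) =
    contradiction (≡.sym (proj₁ (digits-injective (JP x) (J-square y′) (unscale e₀ e₁)))) ξ≢η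
  distinct (inj₂ (inj₁ (i , y′ , z , _))) (inj₁ (j , y , e , x , _)) k (e₀ , e₁ , _) =
    contradiction (proj₁ (digits-injective (J-square y′) (JP x) (unscale e₀ e₁))) ξ≢η
  distinct (inj₂ (inj₁ (i , y , z , _))) (inj₂ (inj₁ (i′ , y′ , z′ , _))) k (e₀ , e₁ , e₂)
    with ξ≡ , _ ← digits-injective (J-square y) (J-square y′) (unscale e₀ e₁)
    with ≡.refl ← ξ-injective ξ≡
    with ≡.refl , h₂ ← digits-injective (JP z) (JP z′) (unscale e₀ e₂)
    with ≡.refl ← P-injective h₂ = ≡.refl
  distinct x@(inj₁ _) y@(inj₂ (inj₂ (inj₁ _))) k h@(e₀ , _) =
    contradiction (J-factor (JP _) e₀) (normalised-unit (vec x) k (normalised y) h)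
  distinct x@(inj₁ _) y@(inj₂ (inj₂ (inj₂ _))) k h@(e₀ , _) =
    contradiction (J-factor (JP _) e₀) (normalised-unit (vec x) k (normalised y) h)
  distinct x@(inj₂ (inj₁ _)) y@(inj₂ (inj₂ (inj₁ _))) k h@(e₀ , _) =
    contradiction (J-factor (JP _) e₀) (normalised-unit (vec x) k (normalised y) h)
  distinct x@(inj₂ (inj₁ _)) y@(inj₂ (inj₂ (inj₂ _))) k h@(e₀ , _) =
    contradiction (J-factor (JP _) e₀) (normalised-unit (vec x) k (normalised y) h)
  distinct (inj₂ (inj₂ (inj₁ _))) (inj₁ _)        k (e₀ , _) = contradiction e₀ (non-unit (JP _))
  distinct (inj₂ (inj₂ (inj₁ _))) (inj₂ (inj₁ _)) k (e₀ , _) = contradiction e₀ (non-unit (JP _))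
  distinct (inj₂ (inj₂ (inj₂ _))) (inj₁ _)        k (e₀ , _) = contradiction e₀ (non-unit (JP _))
  distinct (inj₂ (inj₂ (inj₂ _))) (inj₂ (inj₁ _)) k (e₀ , _) = contradiction e₀ (non-unit (JP _))
  distinct (inj₂ (inj₂ (inj₁ (i , v , u , _)))) (inj₂ (inj₂ (inj₁ (i′ , v′ , u′ , _)))) k (e₀ , e₁ , e₂)
    with ≡.refl ← Fin.inject≤-injective r+t≤q r+t≤q v v′ (P-injective (unscale e₁ e₀))
    with ξ≡ , h₂ ← digits-injective (JP (inject≤ u (width≤q i))) (JP (inject≤ u′ (width≤q i′))) (unscale e₁ e₂)
    with ≡.refl ← ξ-injective ξ≡
    with ≡.refl ← Fin.inject≤-injective (width≤q i) (width≤q i) u u′ (P-injective h₂) = ≡.refl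
  distinct x@(inj₂ (inj₂ (inj₁ _))) y@(inj₂ (inj₂ (inj₂ _))) k h@(_ , e₁ , _) =
    contradiction (J-factor (JP _) e₁) (normalised-unit (vec x) k (normalised y) h)
  distinct (inj₂ (inj₂ (inj₂ _))) (inj₂ (inj₂ (inj₁ _))) k (_ , e₁ , _) = contradiction e₁ (non-unit (JP _))
  distinct (inj₂ (inj₂ (inj₂ (v , u , _)))) (inj₂ (inj₂ (inj₂ (v′ , u′ , _)))) k (e₀ , e₁ , e₂)
    with ≡.refl ← Fin.inject≤-injective apexHeight≤q apexHeight≤q v v′ (P-injective (unscale e₂ e₀))
    with ≡.refl ← Fin.inject≤-injective apexWidth≤q apexWidth≤q u u′ (P-injective (unscale e₂ e₁)) = ≡.refl

  -- With y = z + δ the hypothesis becomes (z + y) δ = ρ δ.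
  root-sum : ∀ {ρ y z} → ¬ y F.≈ z → y F.* y F.+ ρ F.* z F.≈ z F.* z F.+ ρ F.* y → z F.+ y F.≈ ρ
  root-sum {ρ} {y} {z} y≉z e = begin
    z F.+ y                        ≈⟨ F.*-identityʳ _ ⟨
    (z F.+ y) F.* F.1#             ≈⟨ F.*-congˡ δδ⁻¹ ⟨
    (z F.+ y) F.* (δ F.* δ⁻¹)      ≈⟨ F.*-assoc _ _ _ ⟨
    (z F.+ y) F.* δ F.* δ⁻¹        ≈⟨ F.*-congʳ (F.+-cancelˡ (z F.* z F.+ ρ F.* z) _ _ shifted) ⟩
    ρ F.* δ F.* δ⁻¹                ≈⟨ F.*-assoc _ _ _ ⟩
    ρ F.* (δ F.* δ⁻¹)              ≈⟨ F.*-congˡ δδ⁻¹ ⟩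
    ρ F.* F.1#                     ≈⟨ F.*-identityʳ _ ⟩
    ρ                              ∎
    where
    open SetoidReasoning F.setoid
    open SemiringSolver F.commutativeSemiring
    δ = y F.- z
    δ⁻¹ = proj₁ (F.inverse δ λ e → y≉z (F.x∙y⁻¹≈ε⇒x≈y y z e))
    δδ⁻¹ = proj₂ (F.inverse δ λ e → y≉z (F.x∙y⁻¹≈ε⇒x≈y y z e))
    y≈z+δ : y F.≈ z F.+ δ
    y≈z+δ = F.sym (F.trans (F.+-comm _ _) (F.trans (F.+-assoc _ _ _)
      (F.trans (F.+-congˡ (F.-‿inverseˡ z)) (F.+-identityʳ y))))
    shifted : z F.* z F.+ ρ F.* z F.+ (z F.+ y) F.* δ F.≈ z F.* z F.+ ρ F.* z F.+ ρ F.* δ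
    shifted = begin
      z F.* z F.+ ρ F.* z F.+ (z F.+ y) F.* δ
        ≈⟨ F.+-congˡ (F.*-congʳ (F.+-congˡ y≈z+δ)) ⟩
      z F.* z F.+ ρ F.* z F.+ (z F.+ (z F.+ δ)) F.* δ
        ≈⟨ solve 3 (λ z ρ δ → z :* z :+ ρ :* z :+ (z :+ (z :+ δ)) :* δ := (z :+ δ) :* (z :+ δ) :+ ρ :* z) F.refl z ρ δ ⟩
      (z F.+ δ) F.* (z F.+ δ) F.+ ρ F.* z
        ≈⟨ F.+-congʳ (F.*-cong y≈z+δ y≈z+δ) ⟨
      y F.* y F.+ ρ F.* z
        ≈⟨ e ⟩
      z F.* z F.+ ρ F.* y
        ≈⟨ F.+-congˡ (F.*-congˡ y≈z+δ) ⟩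
      z F.* z F.+ ρ F.* (z F.+ δ)
        ≈⟨ solve 3 (λ z ρ δ → z :* z :+ ρ :* (z :+ δ) := z :* z :+ ρ :* z :+ ρ :* δ) F.refl z ρ δ ⟩
      z F.* z F.+ ρ F.* z F.+ ρ F.* δ ∎

  φ-index : ∀ {i} x → φ (S i) F.≈ φ x → i ≡ index x
  φ-index x e = S-injective (F.trans e (F.sym (φ-S-index x)))

  module _ (L : Line) where

    abstract
      -- Abstract, so that `on _ p` can recover its index from the type of `p`.
      load : El shape → ℕ
      load x = incidence (vec x) L

      load-def : ∀ x → load x ≡ incidence (vec x) L
      load-def x = ≡.refl

      on : ∀ x → 0 < load x → vec x ∈ᴾ L
      on x = 0<⟦⟧⇒T _

      load≤1 : ∀ x → load x ≤ 1
      load≤1 x = incidence≤1 (vec x) L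

    -- Lines with a slope.

    private module Graph m h (eq : ∀ {x y z} → (x , y , z) ∈ᴾ L → z ≈ m * y + h * x) where

      -- Modulo the radical the line is the graph of a function, so it meets at most one class in
      -- each affine column.
      residue : ∀ {x x′ y y′} → φ x F.≈ φ x′ → (1# , x , y) ∈ᴾ L → (1# , x′ , y′) ∈ᴾ L → φ y F.≈ φ y′
      residue {x} {x′} e p p′ = F.trans (φ-cong (eq p)) (F.trans (F.trans (φ-+ _ _) (F.trans
        (F.+-congʳ (F.trans (φ-* _ _) (F.trans (F.*-congˡ e) (F.sym (φ-* _ _)))))
        (F.sym (φ-+ _ _)))) (F.sym (φ-cong (eq p′))))

      double-y : ∀ {j y y′ e e′ x x′} → 0 < load (inj₁ (j , y , e , x , tt)) →
                 0 < load (inj₁ (j , y′ , e′ , x′ , tt)) → y ≡ y′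
      double-y {j} {y} {y′} {e} {e′} {x} {x′} p p′ = S-injective (F.trans (F.sym (φ-+J (J-double j e x)))
        (F.trans (residue (F.trans (φ-+J (JP x)) (F.sym (φ-+J (JP x′)))) (on _ p) (on _ p′)) (φ-+J (J-double j e′ x′))))

      -- The right side depends only on the class. If the slopes differ modulo the radical, the
      -- coefficient of `P x` is a unit and each segment is met at most once; if they agree, that
      -- product vanishes and the segment `e` is determined.
      double-difference : ∀ {j y e x} → 0 < load (inj₁ (j , y , e , x , tt)) →
        (S (η j) - m) * P x + E e ≈ (m * S (η j) + h * 1#) - S y
      double-difference {j} {y} {e} {x} p = +-cancelʳ (s′ + Y) _ _ (begin
        (S (η j) - m) * P x + E e + (s′ + Y)   ≈⟨ +-congʳ (+-congʳ (*-distribʳ-minus _ _ _)) ⟩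
        X - Y + E e + (s′ + Y)                 ≈⟨ solve 5 (λ X Y⁻ E s Y → ((X ⊕ᴹ Y⁻) ⊕ᴹ E) ⊕ᴹ (s ⊕ᴹ Y) ⊜ (s ⊕ᴹ (X ⊕ᴹ E)) ⊕ᴹ (Y⁻ ⊕ᴹ Y)) refl X (- Y) (E e) s′ Y ⟩
        s′ + (X + E e) + (- Y + Y)             ≈⟨ +-cong (eq (on _ p)) (-‿inverseˡ Y) ⟩
        m * (S (η j) + P x) + h * 1# + 0#      ≈⟨ +-cong (+-congʳ (distribˡ _ _ _)) (sym (-‿inverseˡ s′)) ⟩
        m * S (η j) + Y + h * 1# + (- s′ + s′) ≈⟨ solve 5 (λ A Y H s⁻ s → ((A ⊕ᴹ Y) ⊕ᴹ H) ⊕ᴹ (s⁻ ⊕ᴹ s) ⊜ ((A ⊕ᴹ H) ⊕ᴹ s⁻) ⊕ᴹ (s ⊕ᴹ Y)) refl (m * S (η j)) Y (h * 1#) (- s′) s′ ⟩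
        m * S (η j) + h * 1# - s′ + (s′ + Y)   ∎)
        where
        open SetoidReasoning setoid
        open CommutativeMonoidSolver +-commutativeMonoid using (solve; _⊜_) renaming (_⊕_ to _⊕ᴹ_)
        s′ = S y
        X = S (η j) * P x
        Y = m * P x

      double-x : ∀ {j y e x x′} → ¬ J (S (η j) - m) → 0 < load (inj₁ (j , y , e , x , tt)) →
                 0 < load (inj₁ (j , y , e , x′ , tt)) → x ≡ x′
      double-x {e = e} u p p′ = P-injective (x∙y⁻¹≈ε⇒x≈y _ _ (unit-cancelˡ u
        (trans (*-distribˡ-minus _ _ _) (trans (+-congʳ (+-cancelʳ (E e) _ _
          (trans (double-difference p) (sym (double-difference p′))))) (-‿inverseʳ _)))))

      double-e : ∀ {j y e e′ x x′} → J (S (η j) - m) → 0 < load (inj₁ (j , y , e , x , tt)) →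
                 0 < load (inj₁ (j , y , e′ , x′ , tt)) → e ≡ e′
      double-e {j} {y} {e} {e′} {x} {x′} Ju p p′ = E-injective (trans (flat e x p) (sym (flat e′ x′ p′)))
        where
        flat : ∀ e x → 0 < load (inj₁ (j , y , e , x , tt)) → E e ≈ (m * S (η j) + h * 1#) - S y
        flat e x p = trans (sym (trans (+-congʳ (J²≈0 Ju (JP x))) (+-identityˡ _))) (double-difference p)

      doubles-at : Fin (2 ℕ.+ t) → ℕ
      doubles-at j = sum λ y → sum λ e → sum λ x → load (inj₁ (j , y , e , x , tt))

      doubles-off : ∀ j → η j ≢ index m → doubles-at j ≤ 2
      doubles-off j ne = sum-at-most-one
        (λ y → sum-≤1 λ e → sum-at-most-one (λ x → load≤1 _) λ x x′ p p′ → double-x u p p′)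
        (λ y y′ p p′ → let e , p = sum-pos p ; x , p = sum-pos p ; e′ , p′ = sum-pos p′ ; x′ , p′ = sum-pos p′ in double-y p p′)
        where
        u : ¬ J (S (η j) - m)
        u Ju = ne (φ-index m (J⇒φ≈ Ju))

      doubles-on : ∀ j → η j ≡ index m → doubles-at j ≤ q
      doubles-on j e = sum-at-most-one
        (λ y → sum-at-most-one
          (λ e → sum-≤1 λ x → load≤1 _)
          (λ e e′ p p′ → let x , p = sum-pos p ; x′ , p′ = sum-pos p′ in double-e Ju p p′))
        (λ y y′ p p′ → let e , p = sum-pos p ; x , p = sum-pos p ; e′ , p′ = sum-pos p′ ; x′ , p′ = sum-pos p′ in double-y p p′)
        where
        Ju : J (S (η j) - m)
        Ju = φ≈⇒J (≡.subst (λ i → φ (S i) F.≈ φ m) (≡.sym e) (φ-S-index m))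

      singles-bound : ∑ singles (λ x → load (inj₂ (inj₁ x))) ≤ r
      singles-bound = sum-≤1 λ i → sum-at-most-one
        (λ y → sum-at-most-one (λ z → load≤1 _) λ z z′ p p′ →
          P-injective (+-cancelˡ _ _ _ (trans (eq (on _ p)) (sym (eq (on _ p′))))))
        (λ y y′ p p′ → let z , p = sum-pos p ; z′ , p′ = sum-pos p′ in
          S-injective (F.trans (F.sym (φ-+J (JP z))) (F.trans
            (residue (F.trans (φ-+J (J-square y)) (F.sym (φ-+J (J-square y′)))) (on _ p) (on _ p′)) (φ-+J (JP z′)))))

      -- The first coordinate is in the radical and the second is 1, so modulo the radical the
      -- equation says that the third coordinate is `m`.
      side-index : ∀ {i v u} → 0 < load (inj₂ (inj₂ (inj₁ (i , v , u , tt)))) → ξ i ≡ index m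
      side-index {i} p = φ-index m (F.trans (F.sym (φ-+J (JP _))) (F.trans (φ-cong (eq (on _ p)))
        (F.trans (φ-+J (J-*ˡ h (JP _))) (φ-cong (*-identityʳ m)))))

      sides-at : ∀ i → sum (λ v → sum λ u → load (inj₂ (inj₂ (inj₁ (i , v , u , tt))))) ≤ r ℕ.+ t
      sides-at i = sum-≤1 λ v → sum-at-most-one (λ u → load≤1 _) λ u u′ p p′ →
        Fin.inject≤-injective (width≤q i) (width≤q i) u u′
          (P-injective (+-cancelˡ _ _ _ (trans (eq (on _ p)) (sym (eq (on _ p′))))))

      apex-bound : ∑ apex (λ x → load (inj₂ (inj₂ (inj₂ x)))) ≤ 0
      apex-bound = ∑-empty apex {λ x → load (inj₂ (inj₂ (inj₂ x)))} λ x p → 1∉J (J-resp (sym (eq (on _ p))) (J-+ (J-*ˡ m (JP _)) (J-*ˡ h (JP _))))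

      bound : ∑ shape load ≤ n
      bound with split (index m)
      -- Slope in X: two points from each of the `2 + t` columns outside X, one from each of the `r`
      -- columns over X, and `r + t` at infinity, in total exactly `n`.
      ... | left i₀ e = ℕ.≤-trans
        (ℕ.+-mono-≤ (sum-≤ {c = 2} λ j → doubles-off j λ e′ → ξ≢η (≡.trans e (≡.sym e′)))
          (ℕ.+-mono-≤ singles-bound
            (ℕ.+-mono-≤ (sum-at-most-one sides-at λ i i′ p p′ →
              let v , p = sum-pos p ; u , p = sum-pos p ; v′ , p′ = sum-pos p′ ; u′ , p′ = sum-pos p′ in
              ξ-injective (≡.trans (side-index p) (≡.sym (side-index p′)))) apex-bound)))
        (ℕ.≤-reflexive (solve 2 (λ r t → (con 2 :+ t) :* con 2 :+ (r :+ ((r :+ t) :+ con 0))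
          := con 2 :* (r :+ (con 2 :+ t)) :+ t) ≡.refl r t))
        where open ℕ-Solver.+-*-Solver
      -- Slope outside X: a full segment of `q` points in the column `j₀`, two points in each of the
      -- `1 + t` others, and one in each of the `r` columns over X, again exactly `n`.
      ... | right j₀ e = ℕ.≤-trans
        (ℕ.+-mono-≤ (sum-peak j₀ (doubles-on j₀ e) λ j ne → doubles-off j λ e′ → ne (η-injective (≡.trans e (≡.sym e′))))
          (ℕ.+-mono-≤ singles-bound
            (ℕ.+-mono-≤ (∑-empty sides {λ x → load (inj₂ (inj₂ (inj₁ x)))} λ x p → ξ≢η (≡.trans (side-index p) (≡.sym e))) apex-bound)))
        (ℕ.≤-reflexive (solve 2 (λ r t → (r :+ (con 2 :+ t)) :+ (con 1 :+ t) :* con 2 :+ (r :+ con 0)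
          := con 2 :* (r :+ (con 2 :+ t)) :+ t) ≡.refl r t))
        where open ℕ-Solver.+-*-Solver

    -- Lines neighbouring a vertical line.

    private module Vertical h p (Jp : J p) (eq : ∀ {x y z} → (x , y , z) ∈ᴾ L → y ≈ h * x + p * z) where

      residue : ∀ {x y} → (1# , x , y) ∈ᴾ L → φ x F.≈ φ h
      residue on = F.trans (φ-cong (eq on)) (F.trans (φ-+J (J-*ʳ _ Jp)) (φ-cong (*-identityʳ h)))

      -- Since `p` annihilates the radical, only the residue digit of the second affine coordinate
      -- enters the equation.
      truncate : ∀ {x y y′} → J y′ → (1# , x , y + y′) ∈ᴾ L → x ≈ h * 1# + p * y
      truncate Jy′ on = trans (eq on) (+-congˡ (trans (distribˡ _ _ _) (trans (+-congˡ (J²≈0 Jp Jy′)) (+-identityʳ _))))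

      double-index : ∀ {j y e x} → 0 < load (inj₁ (j , y , e , x , tt)) → η j ≡ index h
      double-index {x = x} k = φ-index h (F.trans (F.sym (φ-+J (JP x))) (residue (on _ k)))

      single-index : ∀ {i y z} → 0 < load (inj₂ (inj₁ (i , y , z , tt))) → ξ i ≡ index h
      single-index {y = y} k = φ-index h (F.trans (F.sym (φ-+J (J-square y))) (residue (on _ k)))

      -- A single column is met. In each of its `q` classes `truncate` fixes the first affine
      -- coordinate, which determines the position on either segment.
      doubles-bound : ∑ doubles (λ x → load (inj₁ x)) ≤ q ℕ.* 2
      doubles-bound = sum-at-most-one
        (λ j → sum-≤ {c = 2} λ y → sum-≤1 λ e → sum-at-most-one (λ x → load≤1 _) λ x x′ k k′ →
          P-injective (+-cancelˡ _ _ _ (trans (truncate (J-double j e x) (on _ k)) (sym (truncate (J-double j e x′) (on _ k′))))))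
        (λ j j′ k k′ → let y , k = sum-pos k ; e , k = sum-pos k ; x , k = sum-pos k
                           y′ , k′ = sum-pos k′ ; e′ , k′ = sum-pos k′ ; x′ , k′ = sum-pos k′ in
          η-injective (≡.trans (double-index k) (≡.sym (double-index k′))))

      ρ : Carrier
      ρ = proj₁ (J⊆πR Jp)

      -- Writing p = π ρ, the line contains the segment of the class (ξ i , y) exactly when y is a
      -- root of a monic quadratic y² - ρ y + const over the residue field.
      quadratic : ∀ {i y z y′ z′} → 0 < load (inj₂ (inj₁ (i , y , z , tt))) → 0 < load (inj₂ (inj₁ (i , y′ , z′ , tt))) →
        φ (S y) F.* φ (S y) F.+ φ ρ F.* φ (S y′) F.≈ φ (S y′) F.* φ (S y′) F.+ φ ρ F.* φ (S y)
      quadratic {i} {y} {z} {y′} {z′} k k′ = F.trans (F.sym (φ-expand y y′)) (F.trans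
        (J⇒φ≈ (π*-zero⇒J (trans (*-distribˡ-minus π _ _) (trans (+-congʳ swapped) (-‿inverseʳ _))))) (φ-expand y′ y))
        where
        open SetoidReasoning setoid
        open CommutativeMonoidSolver +-commutativeMonoid using (solve; _⊜_) renaming (_⊕_ to _⊕ᴹ_)
        φ-expand : ∀ y y′ → φ (S y * S y + ρ * S y′) F.≈ φ (S y) F.* φ (S y) F.+ φ ρ F.* φ (S y′)
        φ-expand y y′ = F.trans (φ-+ _ _) (F.+-cong (φ-* _ _) (φ-* _ _))
        p* : ∀ y → p * S y ≈ π * (ρ * S y)
        p* y = trans (*-congʳ (proj₂ (J⊆πR Jp))) (*-assoc _ _ _)
        root : ∀ {y z} → 0 < load (inj₂ (inj₁ (i , y , z , tt))) →
               S (ξ i) + π * (S y * S y) ≈ h * 1# + π * (ρ * S y)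
        root {y} {z} k = trans (truncate (JP z) (on _ k)) (+-congˡ (p* y))
        -- Adding one root equation to the reverse of the other cancels `S (ξ i)` and `h * 1#`. As
        -- `π` annihilates only the radical, the factors behind `π` agree modulo it.
        swapped : π * (S y * S y + ρ * S y′) ≈ π * (S y′ * S y′ + ρ * S y)
        swapped = trans (distribˡ _ _ _) (trans (+-cancelˡ (S (ξ i) + h * 1#) _ _ (begin
          S (ξ i) + h * 1# + (Y + Z′)     ≈⟨ solve 4 (λ s h Y Z′ → (s ⊕ᴹ h) ⊕ᴹ (Y ⊕ᴹ Z′) ⊜ (s ⊕ᴹ Y) ⊕ᴹ (h ⊕ᴹ Z′)) refl (S (ξ i)) (h * 1#) Y Z′ ⟩
          (S (ξ i) + Y) + (h * 1# + Z′)   ≈⟨ +-cong (root k) (sym (root k′)) ⟩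
          (h * 1# + Z) + (S (ξ i) + Y′)   ≈⟨ solve 4 (λ s h Y′ Z → (h ⊕ᴹ Z) ⊕ᴹ (s ⊕ᴹ Y′) ⊜ (s ⊕ᴹ h) ⊕ᴹ (Y′ ⊕ᴹ Z)) refl (S (ξ i)) (h * 1#) Y′ Z ⟩
          S (ξ i) + h * 1# + (Y′ + Z)     ∎)) (sym (distribˡ _ _ _)))
          where
          Y = π * (S y * S y)
          Y′ = π * (S y′ * S y′)
          Z = π * (ρ * S y)
          Z′ = π * (ρ * S y′)

      -- By `root-sum` any two distinct roots add up to the residue of `ρ`, so one root determines
      -- the other. At most two classes of the column are met, each in at most `q` points.
      singles-bound : ∑ singles (λ x → load (inj₂ (inj₁ x))) ≤ 2 ℕ.* q
      singles-bound = sum-at-most-one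
        (λ i → sum-at-most-two {c = q} (λ y → sum-≤1 λ z → load≤1 _) λ y y′ y″ k k′ k″ ne ne′ →
          let z , k = sum-pos k ; z′ , k′ = sum-pos k′ ; z″ , k″ = sum-pos k″ in
          S-injective (F.+-cancelʳ (φ (S y)) _ _ (F.trans
            (root-sum (λ e → ne (S-injective e)) (quadratic k k′))
            (F.sym (root-sum (λ e → ne′ (S-injective e)) (quadratic k k″))))))
        (λ i i′ k k′ → let y , k = sum-pos k ; z , k = sum-pos k ; y′ , k′ = sum-pos k′ ; z′ , k′ = sum-pos k′ in
          ξ-injective (≡.trans (single-index k) (≡.sym (single-index k′))))

      sides-bound : ∑ sides (λ x → load (inj₂ (inj₂ (inj₁ x)))) ≤ 0
      sides-bound = ∑-empty sides {λ x → load (inj₂ (inj₂ (inj₁ x)))} λ x k → 1∉J (J-resp (sym (eq (on _ k))) (J-+ (J-*ˡ h (JP _)) (J-*ʳ _ Jp)))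

      -- The equation determines `u` from `v`: each of the at most `t` segments is met at most once.
      apex-bound : ∑ apex (λ x → load (inj₂ (inj₂ (inj₂ x)))) ≤ t
      apex-bound = ℕ.≤-trans (sum-≤1 λ v → sum-at-most-one (λ u → load≤1 _) λ u u′ k k′ →
          Fin.inject≤-injective apexWidth≤q apexWidth≤q u u′ (P-injective (trans (eq (on _ k)) (sym (eq (on _ k′))))))
        apexHeight≤t

      bound : ∑ shape load ≤ n
      bound with split (index h)
      ... | left i₀ e = ℕ.≤-trans
        (ℕ.+-mono-≤ (∑-empty doubles {λ x → load (inj₁ x)} λ x k → ξ≢η (≡.trans e (≡.sym (double-index k))))
          (ℕ.+-mono-≤ singles-bound (ℕ.+-mono-≤ sides-bound apex-bound)))
        ℕ.≤-refl
      ... | right j₀ e = ℕ.≤-trans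
        (ℕ.+-mono-≤ doubles-bound
          (ℕ.+-mono-≤ (∑-empty singles {λ x → load (inj₂ (inj₁ x))} λ x k → ξ≢η (≡.trans (single-index k) (≡.sym e)))
            (ℕ.+-mono-≤ sides-bound apex-bound)))
        (ℕ.≤-reflexive (≡.cong (ℕ._+ t) (ℕ.*-comm q 2)))

    -- Lines neighbouring the line at infinity.

    private module Infinite p p′ (Jp : J p) (Jp′ : J p′) (eq : ∀ {x y z} → (x , y , z) ∈ᴾ L → x ≈ p * y + p′ * z) where

      no-affine : ∀ {x y} → ¬ (1# , x , y) ∈ᴾ L
      no-affine on = 1∉J (J-resp (sym (eq on)) (J-+ (J-*ʳ _ Jp) (J-*ʳ _ Jp′)))

      side-v : ∀ {i v u} → 0 < load (inj₂ (inj₂ (inj₁ (i , v , u , tt)))) →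
               P (inject≤ v r+t≤q) ≈ p * 1# + p′ * S (ξ i)
      side-v k = trans (eq (on _ k)) (+-congˡ (trans (distribˡ _ _ _) (trans (+-congˡ (J²≈0 Jp′ (JP _))) (+-identityʳ _))))

      apex-v : ∀ {v u} → 0 < load (inj₂ (inj₂ (inj₂ (v , u , tt)))) →
               P (inject≤ v apexHeight≤q) ≈ p′ * 1#
      apex-v k = trans (eq (on _ k)) (trans (+-congʳ (J²≈0 Jp (JP _))) (+-identityˡ _))

      -- By `side-v` the line picks at most one segment in each class, but it may contain all of it;
      -- hence the condition on the total width.
      sides-bound : ∑ sides (λ x → load (inj₂ (inj₂ (inj₁ x)))) ≤ sum width
      sides-bound = sum-mono λ i → sum-at-most-one (λ v → sum-≤1 λ u → load≤1 _) λ v v′ k k′ →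
        let u , k = sum-pos k ; u′ , k′ = sum-pos k′ in
        Fin.inject≤-injective r+t≤q r+t≤q v v′ (P-injective (trans (side-v k) (sym (side-v k′))))

      apex-bound : ∑ apex (λ x → load (inj₂ (inj₂ (inj₂ x)))) ≤ apexWidth
      apex-bound = sum-at-most-one (λ v → sum-≤1 λ u → load≤1 _) λ v v′ k k′ →
        let u , k = sum-pos k ; u′ , k′ = sum-pos k′ in
        Fin.inject≤-injective apexHeight≤q apexHeight≤q v v′ (P-injective (trans (apex-v k) (sym (apex-v k′))))

      bound : sum width ℕ.+ apexWidth ≤ n → ∑ shape load ≤ n
      bound h = ℕ.≤-trans (ℕ.+-mono-≤ (∑-empty doubles {λ x → load (inj₁ x)} λ x k → no-affine (on _ k))
        (ℕ.+-mono-≤ (∑-empty singles {λ x → load (inj₂ (inj₁ x))} λ x k → no-affine (on _ k)) (ℕ.+-mono-≤ sides-bound apex-bound))) h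

    load-bound : sum width ℕ.+ apexWidth ≤ n → LineEquation L → ∑ shape load ≤ n
    load-bound h (graph m h′ eq)           = Graph.bound m h′ eq
    load-bound h (vertical h′ p Jp eq)     = Vertical.bound h′ p Jp eq
    load-bound h (infinite p p′ Jp Jp′ eq) = Infinite.bound p p′ Jp Jp′ eq h

  arc : sum width ℕ.+ apexWidth ≤ n → ProjectiveArc (size shape) n
  arc h = projectiveArc shape vec normalised distinct λ L →
    ℕ.≤-trans (ℕ.≤-reflexive (∑-cong shape λ x → ≡.sym (load-def L x))) (load-bound L h (lineEquation L))

  size-shape : size shape ≡ (2 ℕ.+ t) ℕ.* (2 ℕ.* (q ℕ.* q)) ℕ.+ (r ℕ.* (q ℕ.* q) ℕ.+ (sum width ℕ.* (r ℕ.+ t) ℕ.+ apexHeight ℕ.* apexWidth))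
  size-shape = ≡.cong₂ ℕ._+_
    (≡.trans (nest λ j → nest λ y → nest λ e → count q)
      (solve 2 (λ q t → (con 2 :+ t) :* (q :* (con 2 :* q)) := (con 2 :+ t) :* (con 2 :* (q :* q))) ≡.refl q t))
    (≡.cong₂ ℕ._+_ (nest λ i → nest λ y → count q)
      (≡.cong₂ ℕ._+_
        (≡.trans (sum-cong λ i → ≡.trans (nest λ v → count (width i)) (ℕ.*-comm (r ℕ.+ t) (width i))) (sum-*ʳ width (r ℕ.+ t)))
        (nest λ v → count apexWidth)))
    where
    open ℕ-Solver.+-*-Solver
    count : ∀ n → sum {n} (λ _ → 1) ≡ n
    count n = ≡.trans (sum-const n 1) (ℕ.*-identityʳ n)
    nest : ∀ {n c} {f : Fin n → ℕ} → (∀ i → f i ≡ c) → sum f ≡ n ℕ.* c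
    nest {n} {c} h = ≡.trans (sum-cong h) (sum-const n c)

-- Polynomial identities for sizes and degrees.

open import Data.Integer using (ℤ; +_; _+_; _-_; _*_; _^_; _≥_; +≤+)
import Data.Integer.Properties as ℤ
import Data.Integer.Solver as ℤ-Solver

open ℤ-Solver.+-*-Solver using (Polynomial; solve; con; _:+_; _:*_; _:-_; _:=_)

arcSize : (R T W H : ℤ) → ℤ
arcSize R T W H = (+ 2 + T) * (+ 2 * (Q * Q)) + (R * (Q * Q) + (W * (R + T) + H))
  where Q = R + (+ 2 + T)

arcSizeᴾ : ∀ {n} (R T W H : Polynomial n) → Polynomial n
arcSizeᴾ R T W H = (con (+ 2) :+ T) :* (con (+ 2) :* (Q :* Q)) :+ (R :* (Q :* Q) :+ (W :* (R :+ T) :+ H))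
  where Q = R :+ (con (+ 2) :+ T)

-- Written as `Q ^ 2` and `Q ^ 3` unfold, with a final factor 1, so that the solved identities match
-- the stated ones definitionally.
square cube : ∀ {n} → Polynomial n → Polynomial n
square x = x :* (x :* con (+ 1))
cube   x = x :* square x

pos-arcSize : ∀ r t w h → let q = r ℕ.+ (2 ℕ.+ t) in
  + ((2 ℕ.+ t) ℕ.* (2 ℕ.* (q ℕ.* q)) ℕ.+ (r ℕ.* (q ℕ.* q) ℕ.+ (w ℕ.* (r ℕ.+ t) ℕ.+ h)))
  ≡ arcSize (+ r) (+ t) (+ w) (+ h)
pos-arcSize r t w h = ≡.trans (≡.cong₂ (λ x y → x + (y + (+ (w ℕ.* (r ℕ.+ t)) + + h)))
    (≡.trans (ℤ.pos-* (2 ℕ.+ t) (2 ℕ.* (q ℕ.* q)))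
      (≡.cong (+ (2 ℕ.+ t) *_) (≡.trans (ℤ.pos-* 2 (q ℕ.* q)) (≡.cong (+ 2 *_) (ℤ.pos-* q q)))))
    (≡.trans (ℤ.pos-* r (q ℕ.* q)) (≡.cong (+ r *_) (ℤ.pos-* q q))))
  (≡.cong (λ z → (+ 2 + + t) * (+ 2 * (+ q * + q)) + (+ r * (+ q * + q) + (z + + h))) (ℤ.pos-* w (r ℕ.+ t)))
  where q = r ℕ.+ (2 ℕ.+ t)

-- Mirrors the unfolding of `2 ℕ.* q` to `q ℕ.+ (q ℕ.+ 0)`.
double : ∀ {n} → Polynomial n → Polynomial n
double Q = Q :+ (Q :+ con (+ 0))

-- The sizes are named, and unfolded only in lemmas about a variable Q, because normalising
-- integer arithmetic at + q is prohibitively slow.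
size₀ size₁ size₂ : ℤ → ℤ
size₀ Q = + 2 * Q ^ 3 + Q ^ 2 - + 2 * Q
size₁ Q = + 2 * Q ^ 3 + Q ^ 2 - + 5 * Q
size₂ Q = + 2 * Q ^ 3 + Q ^ 2 - + 12 * Q + + 16

size₃ : ℤ → ℤ → ℤ
size₃ Q T = Q ^ 3 + (T + + 4) * Q ^ 2 + (T - + 4) * Q - + 2 * T

arcSize₀ : ∀ T → let Q = + 2 + T in
  arcSize (+ 0) T (+ 0) (T * Q) ≡ size₀ Q
arcSize₀ = solve 1 (λ T → let Q = con (+ 2) :+ T in
  arcSizeᴾ (con (+ 0)) T (con (+ 0)) (T :* Q) := con (+ 2) :* cube Q :+ square Q :- con (+ 2) :* Q) ≡.refl

arcSize₁ : ∀ T → let Q = + 3 + T in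
  arcSize (+ 1) T Q (T * Q) ≡ size₁ Q
arcSize₁ = solve 1 (λ T → let Q = con (+ 3) :+ T in
  arcSizeᴾ (con (+ 1)) T Q (T :* Q) := con (+ 2) :* cube Q :+ square Q :- con (+ 5) :* Q) ≡.refl

arcSize₂ : ∀ T → let Q = + 4 + T in
  arcSize (+ 2) T (Q + (Q + + 0)) (T * T) ≡ size₂ Q
arcSize₂ = solve 1 (λ T → let Q = con (+ 4) :+ T in
  arcSizeᴾ (con (+ 2)) T (Q :+ (Q :+ con (+ 0))) (T :* T) := con (+ 2) :* cube Q :+ square Q :- con (+ 12) :* Q :+ con (+ 16)) ≡.refl

arcSize₃ : ∀ R T → let Q = + 3 + R + (+ 2 + T) in
  arcSize (+ 3 + R) T (Q + (Q + + 0) + T) (+ 0 * + 0)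
  ≡ size₃ Q T
arcSize₃ = solve 2 (λ R T → let Q = con (+ 3) :+ R :+ (con (+ 2) :+ T) in
  arcSizeᴾ (con (+ 3) :+ R) T (Q :+ (Q :+ con (+ 0)) :+ T) (con (+ 0) :* con (+ 0))
  := cube Q :+ (T :+ con (+ 4)) :* square Q :+ (T :- con (+ 4)) :* Q :- con (+ 2) :* T) ≡.refl

-- The hypothesis on `N` follows the unfolding of `2 ℕ.* q ℕ.+ t`, so it holds by `refl` for the
-- actual `n`.
bound₃ : ∀ Q T N → N ≡ Q + (Q + + 0) + T → size₃ Q T ≡ Q * (Q + + 1) * N - Q ^ 3 + + 2 * Q ^ 2 - + 4 * Q - + 2 * T
bound₃ Q T _ ≡.refl = solve 2 (λ Q T → let N = double Q :+ T in
  cube Q :+ (T :+ con (+ 4)) :* square Q :+ (T :- con (+ 4)) :* Q :- con (+ 2) :* T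
  := Q :* (Q :+ con (+ 1)) :* N :- cube Q :+ con (+ 2) :* square Q :- con (+ 4) :* Q :- con (+ 2) :* T) ≡.refl Q T

bound₂ : ∀ Q T N → Q ≡ T + + 4 → N ≡ Q + (Q + + 0) + T → size₂ Q ≡ Q * (Q + + 1) * N - Q ^ 3 + + 2 * Q ^ 2 - + 8 * Q + + 16
bound₂ _ T _ ≡.refl ≡.refl = solve 1 (λ T → let Q = T :+ con (+ 4) ; N = double Q :+ T in
  con (+ 2) :* cube Q :+ square Q :- con (+ 12) :* Q :+ con (+ 16)
  := Q :* (Q :+ con (+ 1)) :* N :- cube Q :+ con (+ 2) :* square Q :- con (+ 8) :* Q :+ con (+ 16)) ≡.refl T

bound₁ : ∀ Q T N → Q ≡ T + + 3 → N ≡ Q + (Q + + 0) + T → size₁ Q ≡ Q * (Q + + 1) * N - Q ^ 3 + Q ^ 2 - + 2 * Q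
bound₁ _ T _ ≡.refl ≡.refl = solve 1 (λ T → let Q = T :+ con (+ 3) ; N = double Q :+ T in
  con (+ 2) :* cube Q :+ square Q :- con (+ 5) :* Q
  := Q :* (Q :+ con (+ 1)) :* N :- cube Q :+ square Q :- con (+ 2) :* Q) ≡.refl T

bound₀ : ∀ Q T N → Q ≡ T + + 2 → N ≡ Q + (Q + + 0) + T → size₀ Q ≡ Q * (Q + + 1) * N - Q ^ 3
bound₀ _ T _ ≡.refl ≡.refl = solve 1 (λ T → let Q = T :+ con (+ 2) ; N = double Q :+ T in
  con (+ 2) :* cube Q :+ square Q :- con (+ 2) :* Q := Q :* (Q :+ con (+ 1)) :* N :- cube Q) ≡.refl T

degree₃ : ∀ Q T N → N ≡ Q + (Q + + 0) + T → N ≡ + 2 * Q + T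
degree₃ Q T _ ≡.refl = solve 2 (λ Q T → double Q :+ T := con (+ 2) :* Q :+ T) ≡.refl Q T

degree₂ : ∀ Q T N → Q ≡ T + + 4 → N ≡ Q + (Q + + 0) + T → N ≡ + 3 * Q - + 4
degree₂ _ T _ ≡.refl ≡.refl = solve 1 (λ T → let Q = T :+ con (+ 4) in double Q :+ T := con (+ 3) :* Q :- con (+ 4)) ≡.refl T

degree₁ : ∀ Q T N → Q ≡ T + + 3 → N ≡ Q + (Q + + 0) + T → N ≡ + 3 * Q - + 3
degree₁ _ T _ ≡.refl ≡.refl = solve 1 (λ T → let Q = T :+ con (+ 3) in double Q :+ T := con (+ 3) :* Q :- con (+ 3)) ≡.refl T

degree₀ : ∀ Q T N → Q ≡ T + + 2 → N ≡ Q + (Q + + 0) + T → N ≡ + 3 * Q - + 2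
degree₀ _ T _ ≡.refl ≡.refl = solve 1 (λ T → let Q = T :+ con (+ 2) in double Q :+ T := con (+ 3) :* Q :- con (+ 2)) ≡.refl T

size₀-def : ∀ Q → size₀ Q ≡ + 2 * Q ^ 3 + Q ^ 2 - + 2 * Q
size₀-def Q = ≡.refl

size₁-def : ∀ Q → size₁ Q ≡ + 2 * Q ^ 3 + Q ^ 2 - + 5 * Q
size₁-def Q = ≡.refl

size₂-def : ∀ Q → size₂ Q ≡ + 2 * Q ^ 3 + Q ^ 2 - + 12 * Q + + 16
size₂-def Q = ≡.refl

size₃-def : ∀ Q T → size₃ Q T ≡ Q ^ 3 + (T + + 4) * Q ^ 2 + (T - + 4) * Q - + 2 * T
size₃-def Q T = ≡.refl

-- Choice of the sets at infinity in the four ranges of `t`.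

module _ {c ℓ a b : Level.Level} {R : Ring c ℓ} where

  ArcOfSize : {q : ℕ} {F : FiniteField a b q} → IsChainRingOfLength2 R F → ℕ → ℤ → Set (c Level.⊔ ℓ)
  ArcOfSize chain n k = ∃ λ k′ → + k′ ≡ k × PHG.ProjectiveArc R (IsChainRingOfLength2.finite chain) k′ n

  resize : {q : ℕ} {F : FiniteField a b q} (chain : IsChainRingOfLength2 R F) → ∀ {n k k′} →
    ArcOfSize chain n k → k ≡ k′ → ArcOfSize chain n k′
  resize chain (j , e , arc) e′ = j , ≡.trans e e′ , arc

  arcOfSize : ∀ r t {F : FiniteField a b (r ℕ.+ (2 ℕ.+ t))} (chain : IsChainRingOfLength2 R F) →
    let q = r ℕ.+ (2 ℕ.+ t) ; n = 2 ℕ.* q ℕ.+ t in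
    (width : Fin r → ℕ) (apexWidth apexHeight w : ℕ) →
    (∀ i → width i ℕ.≤ q) → apexWidth ℕ.≤ q → apexHeight ℕ.≤ t → sum width ≡ w → w ℕ.+ apexWidth ℕ.≤ n →
    ArcOfSize chain n (arcSize (+ r) (+ t) (+ w) (+ apexHeight * + apexWidth))
  arcOfSize r t chain width aw ah w width≤q aw≤q ah≤t ≡.refl fits = _ ,
    ≡.trans (≡.cong +_ (Construction.size-shape r t chain width width≤q aw ah aw≤q ah≤t))
      (≡.trans (pos-arcSize r t w (ah ℕ.* aw)) (≡.cong (arcSize (+ r) (+ t) (+ w)) (ℤ.pos-* ah aw))) ,
    Construction.arc r t chain width width≤q aw ah aw≤q ah≤t fits

  arc₀ : ∀ {q} {F : FiniteField a b q} (chain : IsChainRingOfLength2 R F) t → t ℕ.+ 2 ≡ q → let Q = + q in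
    ArcOfSize chain (2 ℕ.* q ℕ.+ t) (size₀ Q)
  arc₀ chain t h = go (≡.trans (ℕ.+-comm 2 t) h) chain
    where
    -- `q` is quantified before the field and the ring structure, so that matching the equation
    -- rewrites it in their types.
    go : ∀ {q} → 2 ℕ.+ t ≡ q → {F : FiniteField a b q} (chain : IsChainRingOfLength2 R F) →
      ArcOfSize chain (2 ℕ.* q ℕ.+ t) (size₀ (+ q))
    go {q} ≡.refl chain = resize chain
      -- X is empty, and the apex takes `t` full segments of `q` points.
      (arcOfSize 0 t chain (λ ()) (2 ℕ.+ t) t 0 (λ ()) ℕ.≤-refl ℕ.≤-refl (sum-[] _)
        (ℕ.≤-trans (ℕ.m≤m+n (2 ℕ.+ t) _) (ℕ.m≤m+n _ t)))
      (arcSize₀ (+ t))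

  arc₁ : ∀ {q} {F : FiniteField a b q} (chain : IsChainRingOfLength2 R F) t → t ℕ.+ 3 ≡ q → let Q = + q in
    ArcOfSize chain (2 ℕ.* q ℕ.+ t) (size₁ Q)
  arc₁ chain t h = go (≡.trans (ℕ.+-comm 3 t) h) chain
    where
    go : ∀ {q} → 3 ℕ.+ t ≡ q → {F : FiniteField a b q} (chain : IsChainRingOfLength2 R F) →
      ArcOfSize chain (2 ℕ.* q ℕ.+ t) (size₁ (+ q))
    go {q} ≡.refl chain = resize chain
      -- The one side class and the apex both get full segments: a line close to infinity meets at
      -- most `2 q` points.
      (arcOfSize 1 t chain (λ _ → q) q t q (λ _ → ℕ.≤-refl) ℕ.≤-refl ℕ.≤-refl
        (≡.trans (sum-const 1 q) (ℕ.*-identityˡ q))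
        (ℕ.≤-trans (ℕ.≤-reflexive (≡.cong (q ℕ.+_) (≡.sym (ℕ.+-identityʳ q)))) (ℕ.m≤m+n (2 ℕ.* q) t)))
      (arcSize₁ (+ t))

  arc₂ : ∀ {q} {F : FiniteField a b q} (chain : IsChainRingOfLength2 R F) t → t ℕ.+ 4 ≡ q → let Q = + q in
    ArcOfSize chain (2 ℕ.* q ℕ.+ t) (size₂ Q)
  arc₂ chain t h = go (≡.trans (ℕ.+-comm 4 t) h) chain
    where
    go : ∀ {q} → 4 ℕ.+ t ≡ q → {F : FiniteField a b q} (chain : IsChainRingOfLength2 R F) →
      ArcOfSize chain (2 ℕ.* q ℕ.+ t) (size₂ (+ q))
    go {q} ≡.refl chain = resize chain
      -- Two side classes of full width use up `2 q`, which leaves width `t` for the apex.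
      (arcOfSize 2 t chain (λ _ → q) t t (2 ℕ.* q) (λ _ → ℕ.≤-refl) (ℕ.m≤n+m t 4) ℕ.≤-refl (sum-const 2 q) ℕ.≤-refl)
      (arcSize₂ (+ t))

  arc₃ : ∀ {q} {F : FiniteField a b q} (chain : IsChainRingOfLength2 R F) t → t ℕ.+ 5 ℕ.≤ q → let Q = + q ; T = + t in
    ArcOfSize chain (2 ℕ.* q ℕ.+ t) (size₃ Q T)
  arc₃ {q} chain t h = go (q ℕ.∸ (t ℕ.+ 5)) (≡.trans (shift (q ℕ.∸ (t ℕ.+ 5)) t) (ℕ.m+[n∸m]≡n h)) chain
    where
    open ℕ-Solver.+-*-Solver using () renaming (solve to solveℕ; con to conℕ; _:+_ to _:+ℕ_; _:=_ to _:=ℕ_)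
    shift : ∀ r t → 3 ℕ.+ r ℕ.+ (2 ℕ.+ t) ≡ t ℕ.+ 5 ℕ.+ r
    shift = solveℕ 2 (λ r t → conℕ 3 :+ℕ r :+ℕ (conℕ 2 :+ℕ t) :=ℕ t :+ℕ conℕ 5 :+ℕ r) ≡.refl
    go : ∀ r {q} → 3 ℕ.+ r ℕ.+ (2 ℕ.+ t) ≡ q → {F : FiniteField a b q} (chain : IsChainRingOfLength2 R F) → let Q = + q ; T = + t in
      ArcOfSize chain (2 ℕ.* q ℕ.+ t) (size₃ Q T)
    go r {q} ≡.refl chain = resize chain
      -- The remaining width `t` goes to a third side class: it has `q - 2` segments, whereas the
      -- apex, left empty, admits only `t`.
      (arcOfSize (3 ℕ.+ r) t chain width 0 0 (2 ℕ.* q ℕ.+ t) width≤q z≤n z≤n sum-width (ℕ.≤-reflexive (ℕ.+-identityʳ _)))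
      (arcSize₃ (+ r) (+ t))
      where
      width : Fin (3 ℕ.+ r) → ℕ
      width zero                = q
      width (suc zero)          = q
      width (suc (suc zero))    = t
      width (suc (suc (suc _))) = 0
      width≤q : ∀ i → width i ℕ.≤ q
      width≤q zero                = ℕ.≤-refl
      width≤q (suc zero)          = ℕ.≤-refl
      width≤q (suc (suc zero))    = ℕ.≤-trans (ℕ.m≤n+m t 2) (ℕ.m≤n+m (2 ℕ.+ t) (3 ℕ.+ r))
      width≤q (suc (suc (suc _))) = z≤n
      sum-width : sum width ≡ 2 ℕ.* q ℕ.+ t
      sum-width = ≡.trans (sum-∷ width) (≡.trans (≡.cong (q ℕ.+_) (≡.trans (sum-∷ _) (≡.cong (q ℕ.+_) (≡.trans (sum-∷ _)
        (≡.cong (t ℕ.+_) (sum-zero r))))))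
        (solveℕ 2 (λ q t → q :+ℕ (q :+ℕ (t :+ℕ conℕ 0)) :=ℕ (q :+ℕ (q :+ℕ conℕ 0)) :+ℕ t) ≡.refl q t))

  module _ {q : ℕ} {F : FiniteField a b q} (chain : IsChainRingOfLength2 R F) (n : ℕ) where

    m≥ : ∀ {k k′} → ArcOfSize chain n k → k ≡ k′ → + PHG.m[_] R (IsChainRingOfLength2.finite chain) n ≥ k′
    m≥ (j , e , arc) e′ = ≡.subst (+ PHG.m[_] R (IsChainRingOfLength2.finite chain) n ≥_) (≡.trans e e′) (+≤+ (proj₂ (PHG.m-isLargest R (IsChainRingOfLength2.finite chain) n) j arc))

    arcℤ : ∀ {k k′ n′} → ArcOfSize chain n k → k ≡ k′ → + n ≡ n′ → PHG.ProjectiveArcℤ R (IsChainRingOfLength2.finite chain) k′ n′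
    arcℤ (j , e , arc) e′ e″ = j , n , ≡.trans e e′ , e″ , arc

theorem3p3 : ∀ {c ℓ a b} (R : Ring c ℓ) {q : ℕ} → IsPrimePower q →
    (F : FiniteField a b q) (chain : IsChainRingOfLength2 R F) →
    (t n : ℕ) → t ℕ.+ 2 ℕ.≤ q → n ≡ 2 ℕ.* q ℕ.+ t →
    let finite = IsChainRingOfLength2.finite chain
        m = + PHG.m[_] R finite n
        Arc = PHG.ProjectiveArcℤ R finite
        Q = + q
        T = + t
        N = + n
    in
      (t ℕ.+ 5 ℕ.≤ q → m ≥ Q * (Q + + 1) * N - Q ^ 3 + + 2 * Q ^ 2 - + 4 * Q - + 2 * T)
    × (t ℕ.+ 4 ≡ q → m ≥ Q * (Q + + 1) * N - Q ^ 3 + + 2 * Q ^ 2 - + 8 * Q + + 16)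
    × (t ℕ.+ 3 ≡ q → m ≥ Q * (Q + + 1) * N - Q ^ 3 + Q ^ 2 - + 2 * Q)
    × (t ℕ.+ 2 ≡ q → m ≥ Q * (Q + + 1) * N - Q ^ 3)
    × (t ℕ.+ 5 ℕ.≤ q → Arc (Q ^ 3 + (T + + 4) * Q ^ 2 + (T - + 4) * Q - + 2 * T) (+ 2 * Q + T))
    × (t ℕ.+ 4 ≡ q → Arc (+ 2 * Q ^ 3 + Q ^ 2 - + 12 * Q + + 16) (+ 3 * Q - + 4))
    × (t ℕ.+ 3 ≡ q → Arc (+ 2 * Q ^ 3 + Q ^ 2 - + 5 * Q) (+ 3 * Q - + 3))
    × (t ℕ.+ 2 ≡ q → Arc (+ 2 * Q ^ 3 + Q ^ 2 - + 2 * Q) (+ 3 * Q - + 2))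
theorem3p3 R {q} _ F chain t n _ ≡.refl =
    (λ h → m≥ chain n (arc₃ chain t h) (bound₃ (+ q) (+ t) (+ n) ≡.refl))
  , (λ h → m≥ chain n (arc₂ chain t h) (bound₂ (+ q) (+ t) (+ n) (pos h) ≡.refl))
  , (λ h → m≥ chain n (arc₁ chain t h) (bound₁ (+ q) (+ t) (+ n) (pos h) ≡.refl))
  , (λ h → m≥ chain n (arc₀ chain t h) (bound₀ (+ q) (+ t) (+ n) (pos h) ≡.refl))
  , (λ h → arcℤ chain n (arc₃ chain t h) (size₃-def (+ q) (+ t)) (degree₃ (+ q) (+ t) (+ n) ≡.refl))
  , (λ h → arcℤ chain n (arc₂ chain t h) (size₂-def (+ q)) (degree₂ (+ q) (+ t) (+ n) (pos h) ≡.refl))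
  , (λ h → arcℤ chain n (arc₁ chain t h) (size₁-def (+ q)) (degree₁ (+ q) (+ t) (+ n) (pos h) ≡.refl))
  , (λ h → arcℤ chain n (arc₀ chain t h) (size₀-def (+ q)) (degree₀ (+ q) (+ t) (+ n) (pos h) ≡.refl))
  where
  pos : ∀ {c} → t ℕ.+ c ≡ q → + q ≡ + t + + c
  pos h = ≡.cong +_ (≡.sym h)
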